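{- Let $\mathcal{R}$ be a finite valuation ring with residue field of cardinality $q$ and with uniformizer of nilpotency degree $r$ (so $|\mathcal{R}|=q^r$), and let $\mathcal{R}^*$ denote its group of units. Let $G$ be a subgroup of $\mathcal{R}^*$, let $g,h\colon G\to\mathcal{R}^*$ be functions, and let $f(x,y)=g(x)h(y)(x+y)$ for $x,y\in G$. Let $K\ge1$ and assume: (i) for every fixed $z\in G$, the function $x\mapsto g(xz)/g(x)$ takes at most $K$ distinct values on $G$, and the function $x\mapsto h(xz)/h(x)$ takes at most $K$ distinct values on $G$; (ii) for every $u\in G$, $\mu(\varphi_u)\le K$, where $\varphi_u\colon G\to\mathcal{R}$, $\varphi_u(x)=x\,g(x)\,h(ux)$. Then there is a constant $c>0$ depending only on $r$ and $K$ such that for all $A,B,C\subset G$, \[|f(A,B)|\,|A\cdot C|\,|B\cdot C|\ \ge\ c\min\left\{q^r|A||B|,\ \frac{|A|^2|B|^2|C|}{q^{2r-1}}\right\}.\]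
   Context: A finite valuation ring is a finite commutative ring with identity that is local (has a unique maximal ideal) and principal (every ideal is principal); its maximal ideal is generated by a non-unit $z$ (a uniformizer), the residue field $\mathcal{R}/(z)$ has $q$ elements, and $r$ is the least integer with $z^r=0$. For a function $\varphi\colon G\to\mathcal{R}$, $\mu(\varphi)=\max_{t\in\mathcal{R}}|\{x\in G:\varphi(x)=t\}|$. Notation: $f(A,B)=\{f(x,y):x\in A,y\in B\}$, $A\cdot C=\{ac:a\in A,c\in C\}$. -}

module Defs where

open import Algebra.Bundles using (CommutativeRing; Group)
import Algebra.Definitions as AlgDefs
import Algebra.Properties.CommutativeSemigroup as CommSemigroupProps
import Algebra.Properties.Ring as RingProps
import Algebra.Properties.Semiring.Divisibility as SemiringDivisibility
import Algebra.Properties.Semiring.Exp as SemiringExp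
open import Data.Fin.Base using (Fin)
import Data.Fin.Properties as Fin
open import Data.Fin.Subset as Subset using (Subset; ∣_∣; ⊤)
open import Data.Fin.Subset.Properties using (_∈?_)
open import Data.List.Base as List using (allFin)
open import Data.List.Extrema.Nat using (max)
open import Data.Nat.Base as ℕ using (ℕ; NonZero)
open import Data.Product using (∃!)
open import Data.Product.Base using (Σ; ∃; _×_; _,_; proj₁; proj₂)
open import Data.Product.Relation.Binary.Pointwise.NonDependent using (_×ₛ_)
open import Data.Vec.Base using (tabulate)
open import Function.Bundles using (Func; Inverse; _⇔_)
open import Level using (Level; _⊔_) renaming (suc to lsuc)
open import Relation.Binary.Bundles using (Setoid)
open import Relation.Binary.Definitions using () renaming (Decidable to Decidable₂)
open import Relation.Binary.PropositionalEquality as ≡ using (_≡_; _≢_)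
import Relation.Binary.Reasoning.Setoid as SetoidReasoning
open import Relation.Nullary using (¬_; Dec; yes; no; does; map′; _×-dec_)
open import Relation.Unary using (Decidable)

private
  variable
    a ℓ p : Level

HasCardinality : Setoid a ℓ → ℕ → Set (a ⊔ ℓ)
HasCardinality S n = Inverse S (≡.setoid (Fin n))

record FiniteCommutativeRing (a ℓ : Level) : Set (lsuc (a ⊔ ℓ)) where
  field
    commutativeRing : CommutativeRing a ℓ
    size            : ℕ
    enumeration     : HasCardinality (CommutativeRing.setoid commutativeRing) size

  open CommutativeRing commutativeRing public
  open SemiringDivisibility semiring public using (_∣_; _∣0)
  open SemiringExp semiring public using (_^_)
  open Inverse enumeration public
    using ()
    renaming (to to index; from to element; to-cong to index-cong)

  element-index : ∀ x → element (index x) ≈ x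
  element-index x = Inverse.strictlyInverseʳ enumeration x

  infix 4 _≟_ _∈_

  _≟_ : Decidable₂ _≈_
  x ≟ y = map′
    (λ eq → trans (sym (element-index x))
              (trans (reflexive (≡.cong element eq)) (element-index y)))
    index-cong
    (index x Fin.≟ index y)

  -- Subsets of the ring.  They are encoded by sets of indices, which for
  -- a finite ring loses nothing: `Subset size` is the power set of R, its
  -- propositional equality is extensional, and `∣_∣` is the cardinality.

  _∈_ : Carrier → Subset size → Set
  x ∈ A = index x Subset.∈ A

  Elem : Subset size → Set a
  Elem A = ∃ λ x → x ∈ A

  ⟨_⟩ : Subset size → Setoid a ℓ
  ⟨ A ⟩ = record
    { Carrier       = Elem A
    ; _≈_           = λ x y → proj₁ x ≈ proj₁ y
    ; isEquivalence = record { refl = refl ; sym = sym ; trans = trans }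
    }

  include : ∀ {A B} → A Subset.⊆ B → Elem A → Elem B
  include A⊆B (x , x∈A) = x , A⊆B x∈A

  ⟦_⟧ : {P : Carrier → Set p} → Decidable P → Subset size
  ⟦ P? ⟧ = tabulate (λ i → does (P? (element i)))

  ∃-elem? : ∀ A {P : Elem A → Set p} →
            (∀ {x y} → proj₁ x ≈ proj₁ y → P x → P y) →
            Decidable P → Dec (∃ P)
  ∃-elem? A {P} resp P? = map′
    (λ (i , m , pr) → (element i , m) , pr)
    (λ ((x , x∈A) , pr) →
      let x≈ = element-index x in
      index x
      , ≡.subst (Subset._∈ A) (index-cong (sym x≈)) x∈A
      , resp (sym x≈) pr)
    (Fin.any? at)
    where
    at : ∀ i → Dec (Σ (element i ∈ A) λ m → P (element i , m))
    at i with index (element i) ∈? A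
    ... | no ∉A = no (λ (m , _) → ∉A m)
    ... | yes m = map′ (m ,_) (λ (_ , pr) → resp refl pr) (P? (element i , m))

  range : ∀ A → Func ⟨ A ⟩ setoid → Subset size
  range A F = ⟦ (λ t → ∃-elem? A {P = λ x → to x ≈ t}
                  (λ x≈y Fx≈t → trans (cong (sym x≈y)) Fx≈t)
                  (λ x → to x ≟ t)) ⟧
    where open Func F

  range₂ : ∀ A B → Func (⟨ A ⟩ ×ₛ ⟨ B ⟩) setoid → Subset size
  range₂ A B F =
    ⟦ (λ t → ∃-elem? A {P = λ x → ∃ λ y → to (x , y) ≈ t}
         (λ x≈x′ (y , Fxy≈t) → y , trans (cong (sym x≈x′ , refl)) Fxy≈t)
         (λ x → ∃-elem? B {P = λ y → to (x , y) ≈ t}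
           (λ y≈y′ Fxy≈t → trans (cong (refl , sym y≈y′)) Fxy≈t)
           (λ y → to (x , y) ≟ t))) ⟧
    where open Func F

  fibre : ∀ A → Func ⟨ A ⟩ setoid → Carrier → Subset size
  fibre A F t =
    ⟦ (λ x → ∃-elem? A {P = λ y → proj₁ y ≈ x × to y ≈ t}
         (λ y≈y′ (y≈x , Fy≈t) →
           trans (sym y≈y′) y≈x , trans (cong (sym y≈y′)) Fy≈t)
         (λ y → (proj₁ y ≟ x) ×-dec (to y ≟ t))) ⟧
    where open Func F

  μ : ∀ A → Func ⟨ A ⟩ setoid → ℕ
  μ A F = max 0 (List.map (λ i → ∣ fibre A F (element i) ∣) (allFin size))

  infixl 7 _·_

  _·_ : Subset size → Subset size → Subset size
  A · B = range₂ A B record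
    { to   = λ (x , y) → proj₁ x * proj₁ y
    ; cong = λ (x≈x′ , y≈y′) → *-cong x≈x′ y≈y′
    }

  record IsIdeal (I : Subset size) : Set (a ⊔ ℓ) where
    field
      0∈       : 0# ∈ I
      +-closed : ∀ {x y} → x ∈ I → y ∈ I → x + y ∈ I
      *-closed : ∀ s {x} → x ∈ I → s * x ∈ I

  record IsMaximalIdeal (M : Subset size) : Set (a ⊔ ℓ) where
    field
      isIdeal : IsIdeal M
      proper  : M ≢ ⊤
      maximal : ∀ J → IsIdeal J → J ≢ ⊤ → M Subset.⊆ J → M ≡ J

  GeneratedBy : Subset size → Carrier → Set (a ⊔ ℓ)
  GeneratedBy I s = ∀ x → (x ∈ I) ⇔ (s ∣ x)

  IsLocal : Set (a ⊔ ℓ)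
  IsLocal = ∃! _≡_ IsMaximalIdeal

  IsPrincipal : Set (a ⊔ ℓ)
  IsPrincipal = ∀ I → IsIdeal I → ∃ λ s → GeneratedBy I s

  private
    open RingProps ring using (-‿distribˡ-*; -‿+-comm; -‿involutive)
    open SemiringDivisibility semiring using (_,_)
    open SetoidReasoning setoid

    ∣-+ : ∀ {s x y} → s ∣ x → s ∣ y → s ∣ (x + y)
    ∣-+ {s} (u , us≈x) (v , vs≈y) =
      u + v , trans (distribʳ s u v) (+-cong us≈x vs≈y)

    ∣-neg : ∀ {s x} → s ∣ x → s ∣ (- x)
    ∣-neg {s} (u , us≈x) =
      - u , trans (sym (-‿distribˡ-* u s)) (-‿cong us≈x)

    ∣-resp : ∀ {s x y} → x ≈ y → s ∣ x → s ∣ y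
    ∣-resp x≈y (u , us≈x) = u , trans us≈x x≈y

    neg-minus : ∀ x y → - (x - y) ≈ y - x
    neg-minus x y = begin
      - (x - y)      ≈⟨ -‿+-comm x (- y) ⟨
      - x + - (- y)  ≈⟨ +-congˡ (-‿involutive y) ⟩
      - x + y        ≈⟨ +-comm (- x) y ⟩
      y - x          ∎

    telescope : ∀ x y w → (x - y) + (y - w) ≈ x - w
    telescope x y w = begin
      (x - y) + (y - w)    ≈⟨ +-assoc x (- y) (y - w) ⟩
      x + (- y + (y - w))  ≈⟨ +-congˡ (+-assoc (- y) y (- w)) ⟨
      x + ((- y + y) - w)  ≈⟨ +-congˡ (+-congʳ (-‿inverseˡ y)) ⟩
      x + (0# - w)         ≈⟨ +-congˡ (+-identityˡ (- w)) ⟩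
      x - w                ∎

  R/⟨_⟩ : Carrier → Setoid a (a ⊔ ℓ)
  R/⟨ s ⟩ = record
    { Carrier       = Carrier
    ; _≈_           = λ x y → s ∣ (x - y)
    ; isEquivalence = record
      { refl  = λ {x} → ∣-resp (sym (-‿inverseʳ x)) (s ∣0)
      ; sym   = λ {x} {y} s∣ → ∣-resp (neg-minus x y) (∣-neg s∣)
      ; trans = λ {x} {y} {w} s∣₁ s∣₂ → ∣-resp (telescope x y w) (∣-+ s∣₁ s∣₂)
      }
    }

  IsUnit : Carrier → Set (a ⊔ ℓ)
  IsUnit = AlgDefs.Invertible _≈_ 1# _*_

  private
    inverse-unique : ∀ {x y x′ y′} →
                     x ≈ y → x′ * x ≈ 1# → y * y′ ≈ 1# → x′ ≈ y′
    inverse-unique {x} {y} {x′} {y′} x≈y x′x≈1 yy′≈1 = begin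
      x′             ≈⟨ *-identityʳ x′ ⟨
      x′ * 1#        ≈⟨ *-congˡ yy′≈1 ⟨
      x′ * (y * y′)  ≈⟨ *-assoc x′ y y′ ⟨
      (x′ * y) * y′  ≈⟨ *-congʳ (*-congˡ x≈y) ⟨
      (x′ * x) * y′  ≈⟨ *-congʳ x′x≈1 ⟩
      1# * y′        ≈⟨ *-identityˡ y′ ⟩
      y′             ∎

    product-inverse : ∀ {x x′ y y′} →
                      x * x′ ≈ 1# → y * y′ ≈ 1# → (x * y) * (x′ * y′) ≈ 1#
    product-inverse {x} {x′} {y} {y′} xx′≈1 yy′≈1 = begin
      (x * y) * (x′ * y′)  ≈⟨ CommSemigroupProps.interchange *-commutativeSemigroup x y x′ y′ ⟩
      (x * x′) * (y * y′)  ≈⟨ *-cong xx′≈1 yy′≈1 ⟩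
      1# * 1#              ≈⟨ *-identityˡ 1# ⟩
      1#                   ∎

  unitGroup : Group (a ⊔ ℓ) ℓ
  unitGroup = record
    { Carrier = ∃ IsUnit
    ; _≈_     = λ u v → proj₁ u ≈ proj₁ v
    ; _∙_     = λ (x , x′ , x′x , xx′) (y , y′ , y′y , yy′) →
                  x * y , x′ * y′ , product-inverse x′x y′y , product-inverse xx′ yy′
    ; ε       = 1# , 1# , *-identityˡ 1# , *-identityˡ 1#
    ; _⁻¹     = λ (x , x′ , x′x , xx′) → x′ , x , xx′ , x′x
    ; isGroup = record
      { isMonoid = record
        { isSemigroup = record
          { isMagma = record
            { isEquivalence = record { refl = refl ; sym = sym ; trans = trans }
            ; ∙-cong        = *-cong
            }
          ; assoc = λ u v w → *-assoc (proj₁ u) (proj₁ v) (proj₁ w)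
          }
        ; identity = (λ u → *-identityˡ (proj₁ u)) , (λ u → *-identityʳ (proj₁ u))
        }
      ; inverse = (λ (_ , _ , x′x , _) → x′x) , (λ (_ , _ , _ , xx′) → xx′)
      ; ⁻¹-cong = λ {(_ , _ , x′x , _)} {(_ , _ , _ , yy′)} x≈y →
                    inverse-unique x≈y x′x yy′
      }
    }

  module Rˣ = Group unitGroup

  record UnitSubgroup : Set (a ⊔ ℓ) where
    field
      set       : Subset size
      ⊆-units   : ∀ {x} → x ∈ set → IsUnit x
      ε-closed  : proj₁ Rˣ.ε ∈ set
      ∙-closed  : ∀ u v → proj₁ u ∈ set → proj₁ v ∈ set → proj₁ (u Rˣ.∙ v) ∈ set
      ⁻¹-closed : ∀ u → proj₁ u ∈ set → proj₁ (u Rˣ.⁻¹) ∈ set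

    infixl 7 _∙_

    _∙_ : Elem set → Elem set → Elem set
    (x , x∈G) ∙ (y , y∈G) =
      x * y , ∙-closed (x , ⊆-units x∈G) (y , ⊆-units y∈G) x∈G y∈G

    module _ (g : Func ⟨ set ⟩ Rˣ.setoid) where
      private module g = Func g

      ratio : Elem set → Func ⟨ set ⟩ setoid
      ratio z = record
        { to   = λ x → proj₁ (g.to (x ∙ z) Rˣ.// g.to x)
        ; cong = λ {x} {y} x≈y →
            *-cong (g.cong {x ∙ z} {y ∙ z} (*-congʳ x≈y))
                   (Rˣ.⁻¹-cong {g.to x} {g.to y} (g.cong {x} {y} x≈y))
        }

    module _ (g h : Func ⟨ set ⟩ Rˣ.setoid) where
      private
        module g = Func g
        module h = Func h

      φ : Elem set → Func ⟨ set ⟩ setoid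
      φ u = record
        { to   = λ x → proj₁ x * proj₁ (g.to x) * proj₁ (h.to (u ∙ x))
        ; cong = λ {x} {y} x≈y →
            *-cong (*-cong x≈y (g.cong {x} {y} x≈y))
                   (h.cong {u ∙ x} {u ∙ y} (*-congˡ x≈y))
        }

      f : Func (⟨ set ⟩ ×ₛ ⟨ set ⟩) setoid
      f = record
        { to   = λ (x , y) → proj₁ (g.to x) * proj₁ (h.to y) * (proj₁ x + proj₁ y)
        ; cong = λ {(x , y)} {(x′ , y′)} (x≈x′ , y≈y′) →
            *-cong (*-cong (g.cong {x} {x′} x≈x′) (h.cong {y} {y′} y≈y′))
                   (+-cong x≈x′ y≈y′)
        }

    image₂ : Func (⟨ set ⟩ ×ₛ ⟨ set ⟩) setoid →
             ∀ {A B} → A Subset.⊆ set → B Subset.⊆ set → Subset size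
    image₂ F {A} {B} A⊆G B⊆G = range₂ A B record
      { to   = λ (x , y) → F.to (include A⊆G x , include B⊆G y)
      ; cong = F.cong
      }
      where module F = Func F

record FiniteValuationRing (a ℓ : Level) : Set (lsuc (a ⊔ ℓ)) where
  field
    finiteCommutativeRing : FiniteCommutativeRing a ℓ

  open FiniteCommutativeRing finiteCommutativeRing public

  field
    isLocal     : IsLocal
    isPrincipal : IsPrincipal

  IsUniformizer : Carrier → Set (a ⊔ ℓ)
  IsUniformizer z = ¬ IsUnit z × (∃ λ M → IsMaximalIdeal M × GeneratedBy M z)

  HasNilpotencyDegree : Carrier → ℕ → Set ℓ
  HasNilpotencyDegree z r = z ^ r ≈ 0# × (∀ k → k ℕ.< r → ¬ z ^ k ≈ 0#)

  residueCardinality-nonZero : ∀ {z q} → HasCardinality R/⟨ z ⟩ q → NonZero q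
  residueCardinality-nonZero card = Fin.nonZeroIndex (Inverse.to card 0#)

{-# OPTIONS --safe #-}
module Submission where

-- Put X = f(x,y)/g(Y), Y = xw, v = yw and m = w g(Y)/(g(x)h(y)) for (x,y,w) ∈ A × B × C. Then
-- X m = Y + v, so the point (X,Y) lies on the line (m,v). There are at most |f(A,B)||A·C| such points.
-- Since m h(v) = w (g(xw)/g(x)) (h(yw)/h(y)), hypothesis (i) leaves at most K²|C||B·C| lines. With
-- u = v/Y one has m φ_u(x) = Y g(Y), so by (ii) an incidence comes from at most K triples.
-- Hence |A||B||C| is at most K times the number of incidences, which is bounded by a second moment
-- argument: the variance of the number of lines through a point is controlled by the pairs of lines
-- meeting more than once. Their differences lie in (zᵏ)² for some k ≥ 1 and they meet in at most qᵏ
-- points, which costs at most r q^(2r-1) per line because |zᵏR| = q^(r-k).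

open import Defs
import Algebra.Properties.Group as GroupProps
import Algebra.Properties.Ring as RingProps
import Algebra.Properties.Semiring.Divisibility as SemiringDivisibility
import Algebra.Solver.Ring.NaturalCoefficients.Default as SemiringSolver
open import Data.Bool.Base using (if_then_else_)
import Data.Bool.Properties as Bool
open import Data.Fin.Base as Fin using (Fin; toℕ; fromℕ<)
import Data.Fin.Properties as Fin
open import Data.Fin.Subset as Subset using (Subset; ∣_∣; inside; outside; ⊤; _⊆_)
open import Data.Fin.Subset.Properties using (_∈?_; ∈⊤)
import Data.Integer.Properties as ℤ
open import Data.List.Base as List using (List; []; _∷_; map; length; cartesianProduct; allFin)
open import Data.List.Extrema.Nat using (xs≤max)
open import Data.List.Membership.Propositional using () renaming (_∈_ to _∈ₗ_)
open import Data.List.Membership.Propositional.Properties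
  using (∈-allFin; ∈-cartesianProduct⁺; ∈-map⁺; ∈-tabulate⁺)
open import Data.List.Properties using (length-tabulate; map-++; map-∘)
import Data.List.Relation.Unary.All as All
open import Data.List.Relation.Unary.Any using (here; there)
open import Data.Nat.Base as ℕ using (ℕ; NonZero; _∸_; _≤_; _<_; zero; suc; z≤n; s≤s)
open import Data.Nat.ListAction using (sum)
open import Data.Nat.ListAction.Properties using (sum-++)
open import Data.Nat.Properties using (m^n≢0; ≤-trans; ≤-reflexive; m≤n+m∸n; module ≤-Reasoning)
import Data.Nat.Properties as ℕ
open import Data.Nat.Tactic.RingSolver using (solve-∀)
open import Data.Product.Base using (∃; ∃₂; _×_; _,_; proj₁; proj₂)
open import Data.Rational.Unnormalised.Base as ℚᵘ using (ℚᵘ; 0ℚᵘ; _/_; _⊓_)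
import Data.Rational.Unnormalised.Properties as ℚᵘ
open import Data.Sum.Base using (_⊎_; inj₁; inj₂)
open import Data.Vec.Base using ([]; _∷_)
open import Data.Vec.Properties using (≡-dec; []=⇒lookup; lookup⇒[]=; lookup∘tabulate)
open import Function.Base using (_∘_; id)
open import Function.Bundles using (Func; Inverse; Equivalence)
open import Level using (Level)
open import Relation.Binary.Bundles using (Setoid)
open import Relation.Binary.PropositionalEquality as ≡ using (_≡_; _≢_)
open import Relation.Nullary using (¬_; Dec; yes; no; does; contradiction; map′; _×-dec_)
open import Relation.Nullary.Decidable using (dec-true)
open import Relation.Unary using (Decidable)

-- The slope `m` depends on `x`, `y` and `Y` at once and could take far too many values. The factor
-- `h(v)` completes it to a product of ratios, and for fixed `v` multiplication by the unit `h(v)`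
-- is a bijection, so counting the values of `m h(v)` counts the slopes. In the same way, for fixed
-- `Y`, points are counted through `X g(Y)`, which lies in `f(A,B)`. The minimum in the theorem is a
-- dichotomy. For `I` incidences of `Π` points and `Λ` lines over a ring of size `n`, either the
-- mean dominates and `n I ≤ 2 Π Λ`, or the deviation does and `I² ≤ 4 Π Λ e`, where `e` is the
-- total surplus of intersections caused by zero divisors. Each case, combined with the counts of
-- points, lines and triples, carries a spare factor `|C|`; cancelling it leaves one term of the
-- minimum. The incidence argument is valid over every finite commutative ring. The valuation enters
-- only through `n = q^r` and the estimate of `e`.

module FiniteSums where
  open import Data.Nat.Base using (_+_; _*_)
  open import Data.Nat.Properties hiding (_≟_)
  open import Relation.Binary.PropositionalEquality using (refl; cong; cong₂; sym; trans)

  private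
    variable
      ℓ₁ ℓ₂ : Level
      A : Set ℓ₁
      B : Set ℓ₂
      P Q : Set ℓ₁

  -- Sums of natural numbers over lists

  ∑ : List A → (A → ℕ) → ℕ
  ∑ xs F = sum (map F xs)

  ∑-mono : ∀ (xs : List A) {F G : A → ℕ} → (∀ x → F x ≤ G x) → ∑ xs F ≤ ∑ xs G
  ∑-mono []       F≤G = z≤n
  ∑-mono (x ∷ xs) F≤G = +-mono-≤ (F≤G x) (∑-mono xs F≤G)

  ∑-cong : ∀ (xs : List A) {F G : A → ℕ} → (∀ x → F x ≡ G x) → ∑ xs F ≡ ∑ xs G
  ∑-cong xs F≡G = ≤-antisym (∑-mono xs (≤-reflexive ∘ F≡G)) (∑-mono xs (≤-reflexive ∘ sym ∘ F≡G))

  ∑-zero : ∀ (xs : List A) → ∑ xs (λ _ → 0) ≡ 0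
  ∑-zero []       = refl
  ∑-zero (x ∷ xs) = ∑-zero xs

  ∑-distrib-+ : ∀ (xs : List A) (F G : A → ℕ) → ∑ xs (λ x → F x + G x) ≡ ∑ xs F + ∑ xs G
  ∑-distrib-+ []       F G = refl
  ∑-distrib-+ (x ∷ xs) F G rewrite ∑-distrib-+ xs F G = +-swap-middle (F x) (G x) (∑ xs F) (∑ xs G)
    where
    +-swap-middle : ∀ a b c d → a + b + (c + d) ≡ a + c + (b + d)
    +-swap-middle = solve-∀

  ∑-distribˡ-* : ∀ (xs : List A) c (F : A → ℕ) → ∑ xs (λ x → c * F x) ≡ c * ∑ xs F
  ∑-distribˡ-* []       c F = sym (*-zeroʳ c)
  ∑-distribˡ-* (x ∷ xs) c F rewrite ∑-distribˡ-* xs c F = sym (*-distribˡ-+ c (F x) (∑ xs F))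

  ∑-distribʳ-* : ∀ (xs : List A) c (F : A → ℕ) → ∑ xs (λ x → F x * c) ≡ ∑ xs F * c
  ∑-distribʳ-* xs c F = begin
    ∑ xs (λ x → F x * c)  ≡⟨ ∑-cong xs (λ x → *-comm (F x) c) ⟩
    ∑ xs (λ x → c * F x)  ≡⟨ ∑-distribˡ-* xs c F ⟩
    c * ∑ xs F            ≡⟨ *-comm c (∑ xs F) ⟩
    ∑ xs F * c            ∎
    where open ≡.≡-Reasoning

  ∑-const : ∀ (xs : List A) c → ∑ xs (λ _ → c) ≡ length xs * c
  ∑-const []       c = refl
  ∑-const (x ∷ xs) c = cong (c +_) (∑-const xs c)

  ∑-swap : ∀ (xs : List A) (ys : List B) (F : A → B → ℕ) →
           ∑ xs (λ x → ∑ ys (F x)) ≡ ∑ ys (λ y → ∑ xs (λ x → F x y))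
  ∑-swap []       ys F = sym (∑-zero ys)
  ∑-swap (x ∷ xs) ys F = begin
    ∑ ys (F x) + ∑ xs (λ x′ → ∑ ys (F x′))          ≡⟨ cong (∑ ys (F x) +_) (∑-swap xs ys F) ⟩
    ∑ ys (F x) + ∑ ys (λ y → ∑ xs (λ x′ → F x′ y))  ≡⟨ ∑-distrib-+ ys (F x) _ ⟨
    ∑ ys (λ y → F x y + ∑ xs (λ x′ → F x′ y))       ∎
    where open ≡.≡-Reasoning

  ∑-cartesianProduct : ∀ (xs : List A) (ys : List B) (F : A × B → ℕ) →
                       ∑ (cartesianProduct xs ys) F ≡ ∑ xs (λ x → ∑ ys (λ y → F (x , y)))
  ∑-cartesianProduct []       ys F = refl
  ∑-cartesianProduct (x ∷ xs) ys F = begin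
    sum (map F (map (x ,_) ys List.++ cartesianProduct xs ys))
      ≡⟨ cong sum (map-++ F (map (x ,_) ys) _) ⟩
    sum (map F (map (x ,_) ys) List.++ map F (cartesianProduct xs ys))
      ≡⟨ sum-++ (map F (map (x ,_) ys)) _ ⟩
    sum (map F (map (x ,_) ys)) + ∑ (cartesianProduct xs ys) F
      ≡⟨ cong₂ _+_ (cong sum (sym (map-∘ ys))) (∑-cartesianProduct xs ys F) ⟩
    ∑ ys (λ y → F (x , y)) + ∑ xs (λ x′ → ∑ ys (λ y → F (x′ , y)))  ∎
    where open ≡.≡-Reasoning

  ∑-separate : ∀ (xs : List A) (ys : List B) (F : A → ℕ) (G : B → ℕ) →
               ∑ xs (λ x → ∑ ys (λ y → F x * G y)) ≡ ∑ xs F * ∑ ys G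
  ∑-separate xs ys F G = trans
    (∑-cong xs λ x → ∑-distribˡ-* ys (F x) G)
    (∑-distribʳ-* xs (∑ ys G) F)

  term≤∑ : ∀ {xs : List A} (F : A → ℕ) {x} → x ∈ₗ xs → F x ≤ ∑ xs F
  term≤∑ F (here refl)         = m≤m+n _ _
  term≤∑ F (there {x = y} x∈xs) = ≤-trans (term≤∑ F x∈xs) (m≤n+m _ (F y))

  ∑-tabulate-single : ∀ {n} (e : Fin n → A) (F : A → ℕ) j →
                      (∀ i → i ≢ j → F (e i) ≡ 0) → ∑ (List.tabulate e) F ≡ F (e j)
  ∑-tabulate-single {n = suc n} e F Fin.zero vanish = begin
    F (e Fin.zero) + ∑ (List.tabulate (e ∘ Fin.suc)) F  ≡⟨ cong (F (e Fin.zero) +_) rest≡0 ⟩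
    F (e Fin.zero) + 0                                  ≡⟨ +-identityʳ _ ⟩
    F (e Fin.zero)                                      ∎
    where
    open ≡.≡-Reasoning
    vanishing-tail : ∀ {m} (e′ : Fin m → _) → (∀ i → F (e′ i) ≡ 0) → ∑ (List.tabulate e′) F ≡ 0
    vanishing-tail {zero}  e′ eq = refl
    vanishing-tail {suc m} e′ eq = cong₂ _+_ (eq Fin.zero) (vanishing-tail (e′ ∘ Fin.suc) (eq ∘ Fin.suc))
    rest≡0 : ∑ (List.tabulate (e ∘ Fin.suc)) F ≡ 0
    rest≡0 = vanishing-tail (e ∘ Fin.suc) λ i → vanish (Fin.suc i) λ ()
  ∑-tabulate-single {n = suc n} e F (Fin.suc j) vanish = cong₂ _+_
    (vanish Fin.zero λ ())
    (∑-tabulate-single (e ∘ Fin.suc) F j λ i i≢j → vanish (Fin.suc i) (i≢j ∘ Fin.suc-injective))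

  ∑-zero⊎witness : ∀ (xs : List A) (F : A → ℕ) → ∑ xs F ≡ 0 ⊎ ∃ λ x → 0 < F x
  ∑-zero⊎witness [] F = inj₁ refl
  ∑-zero⊎witness (x ∷ xs) F with F x in eq | ∑-zero⊎witness xs F
  ... | suc _ | _         = inj₂ (x , ≡.subst (0 <_) (sym eq) (s≤s z≤n))
  ... | zero  | inj₁ ∑≡0  = inj₁ ∑≡0
  ... | zero  | inj₂ wit  = inj₂ wit

  -- An empty count is 0, so a bound for a count may start from one counted object and use it as a
  -- reference.
  ∑≤-from-witness : ∀ (xs : List A) (F : A → ℕ) c → (∀ x → 0 < F x → ∑ xs F ≤ c) → ∑ xs F ≤ c
  ∑≤-from-witness xs F c bound with ∑-zero⊎witness xs F
  ... | inj₁ ∑≡0       = ≡.subst (_≤ c) (sym ∑≡0) z≤n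
  ... | inj₂ (x , 0<F) = bound x 0<F

  -- Double counting along the relation `ρ`, whose fibres over `ys` are bounded by `k` times the
  -- weight `G`. Where `G` vanishes, the fibre must be empty.
  ∑≤-fibres : ∀ (xs : List A) (ys : List B) (ρ : A → B → ℕ) {F : A → ℕ} {G : B → ℕ} k →
              (∀ x → F x ≤ ∑ ys (ρ x)) → (∀ y → ∑ xs (λ x → ρ x y) ≤ k * G y) →
              ∑ xs F ≤ k * ∑ ys G
  ∑≤-fibres xs ys ρ {F} {G} k F≤ ≤kG = begin
    ∑ xs F                        ≤⟨ ∑-mono xs F≤ ⟩
    ∑ xs (λ x → ∑ ys (ρ x))       ≡⟨ ∑-swap xs ys ρ ⟩
    ∑ ys (λ y → ∑ xs λ x → ρ x y)  ≤⟨ ∑-mono ys ≤kG ⟩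
    ∑ ys (λ y → k * G y)          ≡⟨ ∑-distribˡ-* ys k G ⟩
    k * ∑ ys G                    ∎
    where open ≤-Reasoning

  -- Indicators of decidable propositions

  𝟙 : Dec P → ℕ
  𝟙 P? = if does P? then 1 else 0

  𝟙-yes : (P? : Dec P) → P → 𝟙 P? ≡ 1
  𝟙-yes (yes _) _ = refl
  𝟙-yes (no ¬p) p = contradiction p ¬p

  𝟙-no : (P? : Dec P) → ¬ P → 𝟙 P? ≡ 0
  𝟙-no (yes p) ¬p = contradiction p ¬p
  𝟙-no (no _)  _  = refl

  𝟙≤1 : (P? : Dec P) → 𝟙 P? ≤ 1
  𝟙≤1 (yes _) = ≤-refl
  𝟙≤1 (no _)  = z≤n

  𝟙-true : (P? : Dec P) → 0 < 𝟙 P? → P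
  𝟙-true (yes p) _ = p

  𝟙≤ : (P? : Dec P) {n : ℕ} → (P → 1 ≤ n) → 𝟙 P? ≤ n
  𝟙≤ (yes p) 1≤n = 1≤n p
  𝟙≤ (no _)  _   = z≤n

  𝟙-mono : (P? : Dec P) (Q? : Dec Q) → (P → Q) → 𝟙 P? ≤ 𝟙 Q?
  𝟙-mono P? Q? P→Q = 𝟙≤ P? λ p → ≤-reflexive (sym (𝟙-yes Q? (P→Q p)))

  𝟙-× : (P? : Dec P) (Q? : Dec Q) → 𝟙 (P? ×-dec Q?) ≡ 𝟙 P? * 𝟙 Q?
  𝟙-× (yes _) (yes _) = refl
  𝟙-× (yes _) (no _)  = refl
  𝟙-× (no _)  _       = refl

  𝟙-cong : (P? : Dec P) (Q? : Dec Q) → (P → Q) → (Q → P) → 𝟙 P? ≡ 𝟙 Q?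
  𝟙-cong P? Q? P→Q Q→P = ≤-antisym (𝟙-mono P? Q? P→Q) (𝟙-mono Q? P? Q→P)

  -- Quadratic inequalities and the second moment bound

  2ab≤a²+b² : ∀ a b → 2 * (a * b) ≤ a * a + b * b
  2ab≤a²+b² a b with ≤-total a b
  ... | inj₁ a≤b = ordered a b a≤b
    where
    ordered : ∀ a b → a ≤ b → 2 * (a * b) ≤ a * a + b * b
    ordered a b a≤b with m≤n⇒∃[o]m+o≡n a≤b
    ... | k , refl = ≤-trans (m≤m+n _ (k * k)) (≤-reflexive (square a k))
      where
      square : ∀ a k → 2 * (a * (a + k)) + k * k ≡ a * a + (a + k) * (a + k)
      square = solve-∀
  ... | inj₂ b≤a with m≤n⇒∃[o]m+o≡n b≤a
  ...   | k , refl = ≤-trans (m≤m+n _ (k * k)) (≤-reflexive (square b k))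
      where
      square : ∀ b k → 2 * ((b + k) * b) + k * k ≡ (b + k) * (b + k) + b * b
      square = solve-∀

  cauchy-schwarz : ∀ (xs : List A) (χ d : A → ℕ) →
                   ∑ xs (λ x → χ x * d x) * ∑ xs (λ x → χ x * d x)
                     ≤ ∑ xs χ * ∑ xs (λ x → χ x * (d x * d x))
  cauchy-schwarz [] χ d = z≤n
  cauchy-schwarz (x ∷ xs) χ d = begin
    (w * e + S) * (w * e + S)                    ≡⟨ expandˡ w e S ⟩
    S * S + w * (2 * (S * e)) + w * e * (w * e)  ≤⟨ +-monoˡ-≤ (w * e * (w * e))
                                                      (+-mono-≤ (cauchy-schwarz xs χ d) (*-monoʳ-≤ w cross)) ⟩
    W * D + w * (W * (e * e) + D) + w * e * (w * e) ≡⟨ expandʳ w e W D ⟩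
    (w + W) * (w * (e * e) + D)                  ∎
    where
    open ≤-Reasoning
    w e S W D : ℕ
    w = χ x
    e = d x
    S = ∑ xs λ y → χ y * d y
    W = ∑ xs χ
    D = ∑ xs λ y → χ y * (d y * d y)
    expandˡ : ∀ w e S → (w * e + S) * (w * e + S) ≡ S * S + w * (2 * (S * e)) + w * e * (w * e)
    expandˡ = solve-∀
    expandʳ : ∀ w e W D → W * D + w * (W * (e * e) + D) + w * e * (w * e) ≡ (w + W) * (w * (e * e) + D)
    expandʳ = solve-∀
    rearrange : ∀ χ a b → χ * a * (2 * b) ≡ χ * (2 * (a * b))
    rearrange = solve-∀
    -- The mixed term of the new square is spread over the tail and bounded termwise by `2ab≤a²+b²`;
    -- this is all that the induction step of Cauchy-Schwarz requires.
    cross : 2 * (S * e) ≤ W * (e * e) + D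
    cross = begin
      2 * (S * e)                                    ≡⟨ comm-2 S e ⟩
      S * (2 * e)                                    ≡⟨ ∑-distribʳ-* xs (2 * e) _ ⟨
      ∑ xs (λ y → χ y * d y * (2 * e))               ≤⟨ ∑-mono xs (λ y → ≤-trans
                                                          (≤-reflexive (rearrange (χ y) (d y) e))
                                                          (≤-trans (*-monoʳ-≤ (χ y) (2ab≤a²+b² (d y) e))
                                                          (≤-reflexive (reorder (χ y) (d y) e)))) ⟩
      ∑ xs (λ y → χ y * (e * e) + χ y * (d y * d y)) ≡⟨ ∑-distrib-+ xs _ _ ⟩
      ∑ xs (λ y → χ y * (e * e)) + D                 ≡⟨ cong (_+ D) (∑-distribʳ-* xs (e * e) χ) ⟩
      W * (e * e) + D                                ∎
      where
      comm-2 : ∀ S e → 2 * (S * e) ≡ S * (2 * e)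
      comm-2 = solve-∀
      reorder : ∀ χ a b → χ * (a * a + b * b) ≡ χ * (b * b) + χ * (a * a)
      reorder = solve-∀

  -- If `a ≤ b`, the truncated square is 0 and `2ab≤a²+b²` remains; otherwise this is the expansion
  -- of `(a - b)²`.
  ∸-square : ∀ a b → (a ∸ b) * (a ∸ b) + 2 * (a * b) ≤ a * a + b * b
  ∸-square a b with ≤-total b a
  ... | inj₁ b≤a with m≤n⇒∃[o]m+o≡n b≤a
  ...   | k , refl rewrite m+n∸m≡n b k = ≤-reflexive (square b k)
    where
    square : ∀ b k → k * k + 2 * ((b + k) * b) ≡ (b + k) * (b + k) + b * b
    square = solve-∀
  ∸-square a b | inj₂ a≤b rewrite m≤n⇒m∸n≡0 a≤b = 2ab≤a²+b² a b

  -- If ℓ has mean Λ/n over n² points and variance at most ΛR/n², then its sum over the points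
  -- selected by χ is controlled by the mean or by the variance. The excess d = nℓ ∸ Λ is
  -- truncated, which only helps, as the points with nℓ ≤ Λ need no treatment.
  second-moment :
    ∀ (xs : List A) (χ ℓ : A → ℕ) n Λ R .{{_ : NonZero n}} →
    (∀ x → χ x ≤ 1) →
    length xs ≡ n * n →
    ∑ xs ℓ ≡ Λ * n →
    ∑ xs (λ x → ℓ x * ℓ x) ≤ Λ * Λ + Λ * R →
    let I = ∑ xs λ x → χ x * ℓ x
        Π = ∑ xs χ
    in n * I ≤ 2 * (Π * Λ) ⊎ I * I ≤ 4 * (Π * Λ * R)
  second-moment xs χ ℓ n Λ R χ≤1 len mean moment = split
    where
    open ≤-Reasoning
    I Π D V : ℕ
    d : _ → ℕ
    I = ∑ xs λ x → χ x * ℓ x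
    Π = ∑ xs χ
    d x = n * ℓ x ∸ Λ
    D = ∑ xs λ x → χ x * d x
    V = ∑ xs λ x → d x * d x

    variance : V ≤ n * n * (Λ * R)
    -- The cross term `2 n² Λ²` of the expanded variance is added to both sides, which avoids
    -- subtraction; by `mean` it equals the sum of `2 n Λ ℓ`.
    variance = +-cancelʳ-≤ (2 * (n * n * (Λ * Λ))) V (n * n * (Λ * R)) (begin
      V + 2 * (n * n * (Λ * Λ))
        ≡⟨ cong (V +_) (r₁ n Λ) ⟩
      V + 2 * n * Λ * (Λ * n)
        ≡⟨ cong (λ m → V + 2 * n * Λ * m) mean ⟨
      V + 2 * n * Λ * ∑ xs ℓ
        ≡⟨ cong (V +_) (∑-distribˡ-* xs (2 * n * Λ) ℓ) ⟨
      V + ∑ xs (λ x → 2 * n * Λ * ℓ x)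
        ≡⟨ ∑-distrib-+ xs _ _ ⟨
      ∑ xs (λ x → d x * d x + 2 * n * Λ * ℓ x)
        ≤⟨ ∑-mono xs (λ x → ≤-trans
             (≤-reflexive (cong (d x * d x +_) (r₂ n Λ (ℓ x))))
             (≤-trans (∸-square (n * ℓ x) Λ)
               (≤-reflexive (cong (_+ Λ * Λ) (r₃ n (ℓ x)))))) ⟩
      ∑ xs (λ x → n * n * (ℓ x * ℓ x) + Λ * Λ)
        ≡⟨ ∑-distrib-+ xs _ _ ⟩
      ∑ xs (λ x → n * n * (ℓ x * ℓ x)) + ∑ xs (λ _ → Λ * Λ)
        ≡⟨ cong₂ _+_ (∑-distribˡ-* xs (n * n) _) (trans (∑-const xs (Λ * Λ)) (cong (_* (Λ * Λ)) len)) ⟩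
      n * n * ∑ xs (λ x → ℓ x * ℓ x) + n * n * (Λ * Λ)
        ≤⟨ +-monoˡ-≤ (n * n * (Λ * Λ)) (*-monoʳ-≤ (n * n) moment) ⟩
      n * n * (Λ * Λ + Λ * R) + n * n * (Λ * Λ)
        ≡⟨ r₄ (n * n) Λ R ⟩
      n * n * (Λ * R) + 2 * (n * n * (Λ * Λ)) ∎)
      where
      r₁ : ∀ n Λ → 2 * (n * n * (Λ * Λ)) ≡ 2 * n * Λ * (Λ * n)
      r₁ = solve-∀
      r₂ : ∀ n Λ l → 2 * n * Λ * l ≡ 2 * (n * l * Λ)
      r₂ = solve-∀
      r₃ : ∀ n l → n * l * (n * l) ≡ n * n * (l * l)
      r₃ = solve-∀
      r₄ : ∀ m Λ R → m * (Λ * Λ + Λ * R) + m * (Λ * Λ) ≡ m * (Λ * R) + 2 * (m * (Λ * Λ))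
      r₄ = solve-∀

    nI≤D+ΠΛ : n * I ≤ D + Π * Λ
    nI≤D+ΠΛ = begin
      n * I
        ≡⟨ ∑-distribˡ-* xs n _ ⟨
      ∑ xs (λ x → n * (χ x * ℓ x))
        ≤⟨ ∑-mono xs (λ x → ≤-trans (≤-reflexive (r (χ x) n (ℓ x)))
             (≤-trans (*-monoʳ-≤ (χ x) (≤-trans (m≤n+m∸n (n * ℓ x) Λ) (≤-reflexive (+-comm Λ (d x)))))
               (≤-reflexive (*-distribˡ-+ (χ x) (d x) Λ)))) ⟩
      ∑ xs (λ x → χ x * d x + χ x * Λ)
        ≡⟨ ∑-distrib-+ xs _ _ ⟩
      D + ∑ xs (λ x → χ x * Λ)
        ≡⟨ cong (D +_) (∑-distribʳ-* xs Λ χ) ⟩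
      D + Π * Λ ∎
      where
      r : ∀ χ n l → n * (χ * l) ≡ χ * (n * l)
      r = solve-∀

    D²≤ : D * D ≤ Π * (n * n * (Λ * R))
    D²≤ = begin
      D * D                                    ≤⟨ cauchy-schwarz xs χ d ⟩
      Π * ∑ xs (λ x → χ x * (d x * d x))       ≤⟨ *-monoʳ-≤ Π (∑-mono xs λ x →
                                                    ≤-trans (*-monoˡ-≤ (d x * d x) (χ≤1 x)) (≤-reflexive (*-identityˡ _))) ⟩
      Π * V                                    ≤⟨ *-monoʳ-≤ Π variance ⟩
      Π * (n * n * (Λ * R))                    ∎

    split : n * I ≤ 2 * (Π * Λ) ⊎ I * I ≤ 4 * (Π * Λ * R)
    -- The larger summand in `nI≤D+ΠΛ` decides: the mean `Π Λ` gives the linear bound, the deviation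
    -- `D` gives `n I ≤ 2 D`, which is squared and divided by `n²`.
    split with ≤-total D (Π * Λ)
    ... | inj₁ D≤ΠΛ = inj₁ (≤-trans nI≤D+ΠΛ (≤-trans (+-monoˡ-≤ (Π * Λ) D≤ΠΛ) (≤-reflexive (double (Π * Λ)))))
      where
      double : ∀ m → m + m ≡ 2 * m
      double = solve-∀
    ... | inj₂ ΠΛ≤D = inj₂ (*-cancelˡ-≤ (n * n) {{m*n≢0 n n}} (begin
      n * n * (I * I)            ≡⟨ r₁ n I ⟩
      n * I * (n * I)            ≤⟨ *-mono-≤ nI≤2D nI≤2D ⟩
      2 * D * (2 * D)            ≡⟨ r₂ D ⟩
      4 * (D * D)                ≤⟨ *-monoʳ-≤ 4 D²≤ ⟩
      4 * (Π * (n * n * (Λ * R))) ≡⟨ r₃ n Π Λ R ⟩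
      n * n * (4 * (Π * Λ * R))  ∎))
      where
      nI≤2D : n * I ≤ 2 * D
      nI≤2D = ≤-trans nI≤D+ΠΛ (≤-trans (+-monoʳ-≤ D ΠΛ≤D) (≤-reflexive (double D)))
        where
        double : ∀ m → m + m ≡ 2 * m
        double = solve-∀
      r₁ : ∀ n I → n * n * (I * I) ≡ n * I * (n * I)
      r₁ = solve-∀
      r₂ : ∀ D → 2 * D * (2 * D) ≡ 4 * (D * D)
      r₂ = solve-∀
      r₃ : ∀ n Π Λ R → 4 * (Π * (n * n * (Λ * R))) ≡ n * n * (4 * (Π * Λ * R))
      r₃ = solve-∀

open FiniteSums

private
  variable
    p ℓ₁ : Level
    X : Set ℓ₁

-- Point-line incidences over a finite commutative ring

-- The enumeration `e` is arbitrary so that the induction can pass to `e ∘ Fin.suc`.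
∣∣≡∑ : ∀ {n} (e : Fin n → X) (A : Subset n) {F : X → ℕ} →
       (∀ i → F (e i) ≡ 𝟙 (i ∈? A)) → ∣ A ∣ ≡ ∑ (List.tabulate e) F
∣∣≡∑ e []            eq = ≡.refl
∣∣≡∑ e (inside  ∷ A) eq = ≡.cong₂ ℕ._+_ (≡.sym (eq Fin.zero)) (∣∣≡∑ (e ∘ Fin.suc) A (eq ∘ Fin.suc))
∣∣≡∑ e (outside ∷ A) eq = ≡.cong₂ ℕ._+_ (≡.sym (eq Fin.zero)) (∣∣≡∑ (e ∘ Fin.suc) A (eq ∘ Fin.suc))

module FiniteRingCounting {a ℓ} (R : FiniteCommutativeRing a ℓ) where
  open FiniteCommutativeRing R
  open GroupProps +-group using (x≈y⇒x∙y⁻¹≈ε; //-rightDividesˡ; //-rightDividesʳ)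
  open RingProps ring using (x[y-z]≈xy-xz)
  import Relation.Binary.Reasoning.Setoid setoid as ≈-Reasoning

  index-element : ∀ i → index (element i) ≡ i
  index-element = Inverse.strictlyInverseˡ enumeration

  E : List Carrier
  E = List.tabulate element

  E² : List (Carrier × Carrier)
  E² = cartesianProduct E E

  length-E : length E ≡ size
  length-E = length-tabulate element

  -- List membership is propositional, whereas equality in the ring is `≈`. A computed element
  -- therefore has to be replaced by its listed representative before it can name a term of a sum
  -- over `E`.
  representative : ∀ x → ∃ λ y → y ∈ₗ E × y ≈ x
  representative x = element (index x) , ∈-tabulate⁺ (index x) , element-index x

  ∑-E-one : ∑ E (λ _ → 1) ≡ size
  ∑-E-one = ≡.trans (∑-const E 1) (≡.trans (ℕ.*-identityʳ _) length-E)

  ∑-E² : ∀ F → ∑ E² F ≡ ∑ E λ x → ∑ E λ y → F (x , y)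
  ∑-E² = ∑-cartesianProduct E E

  ∈-resp : ∀ {A x y} → x ≈ y → x ∈ A → y ∈ A
  ∈-resp {A} x≈y = ≡.subst (Subset._∈ A) (index-cong x≈y)

  Respectful : (Carrier → ℕ) → Set _
  Respectful F = ∀ {x y} → x ≈ y → F x ≡ F y

  ∑-single : ∀ x {F} → Respectful F → (∀ y → ¬ y ≈ x → F y ≡ 0) → ∑ E F ≡ F x
  ∑-single x {F} F-resp vanish = ≡.trans
    (∑-tabulate-single element F (index x) λ i i≢ → vanish (element i) λ ei≈x →
      i≢ (≡.trans (≡.sym (index-element i)) (index-cong ei≈x)))
    (F-resp (element-index x))

  ∑-unique : ∀ {P : Carrier → Set p} (P? : Decidable P) x →
             (∀ y → y ≈ x → P y) → (∀ y → P y → y ≈ x) → ∑ E (𝟙 ∘ P?) ≡ 1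
  ∑-unique P? x ≈⇒P P⇒≈ = ≡.trans
    (∑-single x (λ {y} {w} y≈w → 𝟙-cong (P? y) (P? w)
                  (λ Py → ≈⇒P w (trans (sym y≈w) (P⇒≈ y Py)))
                  (λ Pw → ≈⇒P y (trans y≈w (P⇒≈ w Pw))))
                (λ y y≉x → 𝟙-no (P? y) (y≉x ∘ P⇒≈ y)))
    (𝟙-yes (P? x) (≈⇒P x refl))

  -- Expand `F (φ x)` as the sum over `w` of `𝟙 (φ x ≟ w)` times `F w`, then swap the sums: each `w`
  -- has the single preimage `ψ w`.
  ∑-reindex : ∀ (φ ψ : Carrier → Carrier) → (∀ x w → φ x ≈ w → x ≈ ψ w) → (∀ x w → x ≈ ψ w → φ x ≈ w) →
              ∀ {F} → Respectful F → ∑ E (F ∘ φ) ≡ ∑ E F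
  ∑-reindex φ ψ φ⇒ψ ψ⇒φ {F} F-resp = begin
    ∑ E (F ∘ φ)
      ≡⟨ ∑-cong E (λ x → ≡.sym (≡.trans
           (∑-single (φ x)
             (λ {y} {w} y≈w → ≡.cong₂ ℕ._*_
               (𝟙-cong (φ x ≟ y) (φ x ≟ w) (λ eq → trans eq y≈w) (λ eq → trans eq (sym y≈w)))
               (F-resp y≈w))
             (λ y y≉ → ≡.cong (ℕ._* F y) (𝟙-no (φ x ≟ y) (y≉ ∘ sym))))
           (≡.trans (≡.cong (ℕ._* F (φ x)) (𝟙-yes (φ x ≟ φ x) refl)) (ℕ.*-identityˡ _)))) ⟩
    ∑ E (λ x → ∑ E λ w → 𝟙 (φ x ≟ w) ℕ.* F w)
      ≡⟨ ∑-swap E E _ ⟩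
    ∑ E (λ w → ∑ E λ x → 𝟙 (φ x ≟ w) ℕ.* F w)
      ≡⟨ ∑-cong E (λ w → ≡.trans (∑-distribʳ-* E (F w) _)
           (≡.trans (≡.cong (ℕ._* F w)
             (∑-unique (λ x → φ x ≟ w) (ψ w) (λ x → ψ⇒φ x w) (λ x → φ⇒ψ x w)))
             (ℕ.*-identityˡ _))) ⟩
    ∑ E F ∎
    where open ≡.≡-Reasoning

  x-y≈w⇒x≈w+y : ∀ {x y w} → x - y ≈ w → x ≈ w + y
  x-y≈w⇒x≈w+y {x} {y} eq = trans (sym (//-rightDividesˡ y x)) (+-congʳ eq)

  x≈w+y⇒x-y≈w : ∀ {x y w} → x ≈ w + y → x - y ≈ w
  x≈w+y⇒x-y≈w {x} {y} {w} eq = trans (+-congʳ eq) (//-rightDividesʳ y w)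

  x-y≈w⇒y≈x-w : ∀ {x y w} → x - y ≈ w → y ≈ x - w
  x-y≈w⇒y≈x-w eq = sym (x≈w+y⇒x-y≈w (trans (x-y≈w⇒x≈w+y eq) (+-comm _ _)))

  ∑-translate : ∀ y {F} → Respectful F → ∑ E (λ x → F (x - y)) ≡ ∑ E F
  ∑-translate y = ∑-reindex (_- y) (_+ y) (λ _ _ → x-y≈w⇒x≈w+y) (λ _ _ → x≈w+y⇒x-y≈w)

  ∑-reflect : ∀ y {F} → Respectful F → ∑ E (λ x → F (y - x)) ≡ ∑ E F
  ∑-reflect y = ∑-reindex (λ x → y - x) (λ x → y - x) (λ _ _ → x-y≈w⇒y≈x-w) (λ _ _ → sym ∘ x-y≈w⇒y≈x-w ∘ sym)

  ∑-scale : ∀ u v → u * v ≈ 1# → ∀ {F} → Respectful F → ∑ E (λ x → F (x * u)) ≡ ∑ E F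
  ∑-scale u v uv≈1 = ∑-reindex (_* u) (_* v)
    (λ x w xu≈w → sym (trans (*-congʳ (sym xu≈w)) (cancel x u v uv≈1)))
    (λ x w x≈wv → trans (*-congʳ x≈wv) (cancel w v u (trans (*-comm v u) uv≈1)))
    where
    cancel : ∀ x u v → u * v ≈ 1# → x * u * v ≈ x
    cancel x u v eq = trans (*-assoc x u v) (trans (*-congˡ eq) (*-identityʳ x))

  ∣A∣≡∑ : ∀ A → ∣ A ∣ ≡ ∑ E λ x → 𝟙 (index x ∈? A)
  ∣A∣≡∑ A = ∣∣≡∑ element A λ i → ≡.cong (λ j → 𝟙 (j ∈? A)) (index-element i)

  𝟙∈-resp : ∀ A → Respectful (λ x → 𝟙 (index x ∈? A))
  𝟙∈-resp A x≈y = ≡.cong (λ j → 𝟙 (j ∈? A)) (index-cong x≈y)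

  ∈⟦⟧⁺ : ∀ {P : Carrier → Set p} (P? : Decidable P) {x} → P (element (index x)) → x ∈ ⟦ P? ⟧
  ∈⟦⟧⁺ P? {x} Px = lookup⇒[]= (index x) _
    (≡.trans (lookup∘tabulate _ (index x)) (dec-true (P? _) Px))

  ∈-range⁺ : ∀ A F (x : Elem A) {t} → Func.to F x ≈ t → t ∈ range A F
  ∈-range⁺ A F x Fx≈t = ∈⟦⟧⁺
    (λ t → ∃-elem? A {P = λ x → to x ≈ t} (λ x≈y Fx≈t → trans (cong (sym x≈y)) Fx≈t) (λ x → to x ≟ t))
    (x , trans Fx≈t (sym (element-index _)))
    where open Func F

  ∈-range₂⁺ : ∀ A B F (x : Elem A) (y : Elem B) {t} → Func.to F (x , y) ≈ t → t ∈ range₂ A B F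
  ∈-range₂⁺ A B F x y Fxy≈t = ∈⟦⟧⁺
    (λ t → ∃-elem? A {P = λ x → ∃ λ y → to (x , y) ≈ t}
      (λ x≈x′ (y , Fxy≈t) → y , trans (cong (sym x≈x′ , refl)) Fxy≈t)
      (λ x → ∃-elem? B {P = λ y → to (x , y) ≈ t}
        (λ y≈y′ Fxy≈t → trans (cong (refl , sym y≈y′)) Fxy≈t)
        (λ y → to (x , y) ≟ t)))
    (x , y , trans Fxy≈t (sym (element-index _)))
    where open Func F

  ∈-·⁺ : ∀ A B (x : Elem A) (y : Elem B) {t} → proj₁ x * proj₁ y ≈ t → t ∈ A · B
  ∈-·⁺ A B = ∈-range₂⁺ A B record
    { to   = λ (x , y) → proj₁ x * proj₁ y
    ; cong = λ (x≈x′ , y≈y′) → *-cong x≈x′ y≈y′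
    }

  ∈-fibre⁺ : ∀ A F (x : Elem A) {y t} → proj₁ x ≈ y → Func.to F x ≈ t → y ∈ fibre A F t
  ∈-fibre⁺ A F x {t = t} x≈y Fx≈t = ∈⟦⟧⁺
    (λ x → ∃-elem? A {P = λ y → proj₁ y ≈ x × to y ≈ t}
      (λ y≈y′ (y≈x , Fy≈t) → trans (sym y≈y′) y≈x , trans (cong (sym y≈y′)) Fy≈t)
      (λ y → (proj₁ y ≟ x) ×-dec (to y ≟ t)))
    (x , trans x≈y (sym (element-index _)) , Fx≈t)
    where open Func F

  ∣fibre∣≤μ : ∀ A F i → ∣ fibre A F (element i) ∣ ≤ μ A F
  ∣fibre∣≤μ A F i = All.lookup (xs≤max 0 _) (∈-map⁺ (λ i → ∣ fibre A F (element i) ∣) (∈-allFin i))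

  -- Lines in the plane over the ring and their intersections

  solutions : Carrier → Carrier → ℕ
  solutions d w = ∑ E λ x → 𝟙 (x * d ≟ w)

  solutions-cong : ∀ {d d′ w w′} → d ≈ d′ → w ≈ w′ → solutions d w ≡ solutions d′ w′
  solutions-cong {d} {d′} {w} {w′} d≈ w≈ = ∑-cong E λ x → 𝟙-cong (x * d ≟ w) (x * d′ ≟ w′)
    (λ eq → trans (*-congˡ (sym d≈)) (trans eq w≈))
    (λ eq → trans (*-congˡ d≈) (trans eq (sym w≈)))

  -- Two lines with coefficient difference (d , w) meet in `solutions d w` points.
  excess : ℕ
  excess = ∑ E λ d → ∑ E λ w → solutions d w ∸ 1

  -- The line `(m , v)` is the graph of `x ↦ x m - v`, hence it has one point above each `x`.
  incident : Carrier × Carrier → Carrier × Carrier → ℕ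
  incident (x , y) (m , v) = 𝟙 (x * m ≟ y + v)

  point-unique : ∀ x m v → ∑ E (λ y → incident (x , y) (m , v)) ≡ 1
  point-unique x m v = ∑-unique (λ y → x * m ≟ y + v) (x * m - v)
    (λ y eq → x-y≈w⇒x≈w+y (sym eq)) (λ y eq → sym (x≈w+y⇒x-y≈w eq))

  points-on-line : ∀ l → ∑ E² (λ p → incident p l) ≡ size
  points-on-line (m , v) = ≡.trans (∑-E² _) (≡.trans (∑-cong E λ x → point-unique x m v) ∑-E-one)

  -- Subtracting the two line equations eliminates `y` and leaves `x (m - m′) = v - v′`; above each
  -- such `x` there is at most one common point.
  common-points : ∀ m v m′ v′ →
    ∑ E² (λ p → incident p (m , v) ℕ.* incident p (m′ , v′)) ≤ solutions (m - m′) (v - v′)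
  common-points m v m′ v′ = ≤-trans (≤-reflexive (∑-E² _)) (∑-mono E λ x →
    ∑≤-from-witness E _ _ λ y both → begin
      ∑ E (λ y → 𝟙 (x * m ≟ y + v) ℕ.* 𝟙 (x * m′ ≟ y + v′))
        ≤⟨ ∑-mono E (λ y → ≤-trans (ℕ.*-monoʳ-≤ (𝟙 (x * m ≟ y + v)) (𝟙≤1 (x * m′ ≟ y + v′)))
             (≤-reflexive (ℕ.*-identityʳ _))) ⟩
      ∑ E (λ y → 𝟙 (x * m ≟ y + v))
        ≡⟨ point-unique x m v ⟩
      1
        ≡⟨ 𝟙-yes (x * (m - m′) ≟ v - v′) (difference x y
             (𝟙-true (x * m ≟ y + v) (0<-left both))
             (𝟙-true (x * m′ ≟ y + v′) (0<-right {𝟙 (x * m ≟ y + v)} both))) ⟨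
      𝟙 (x * (m - m′) ≟ v - v′) ∎)
    where
    open ≤-Reasoning
    0<-left : ∀ {m n} → 0 < m ℕ.* n → 0 < m
    0<-left {suc m} _ = s≤s z≤n
    0<-right : ∀ {m n} → 0 < m ℕ.* n → 0 < n
    0<-right {m} {zero}  0<mn = contradiction (≡.subst (0 <_) (ℕ.*-zeroʳ m) 0<mn) λ ()
    0<-right {m} {suc n} _    = s≤s z≤n
    difference : ∀ x y → x * m ≈ y + v → x * m′ ≈ y + v′ → x * (m - m′) ≈ v - v′
    difference x y eq eq′ = trans (x[y-z]≈xy-xz x m m′) (x≈w+y⇒x-y≈w (R.begin
      x * m                R.≈⟨ eq ⟩
      y + v                R.≈⟨ +-congˡ (sym (//-rightDividesˡ v′ v)) ⟩
      y + (v - v′ + v′)    R.≈⟨ +-congˡ (+-comm _ _) ⟩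
      y + (v′ + (v - v′))  R.≈⟨ sym (+-assoc _ _ _) ⟩
      y + v′ + (v - v′)    R.≈⟨ +-congʳ (sym eq′) ⟩
      x * m′ + (v - v′)    R.≈⟨ +-comm _ _ ⟩
      v - v′ + x * m′      R.∎))
      where module R = ≈-Reasoning

  -- For a fixed line, passing to the difference permutes all pairs of coefficients, so every line
  -- sees the same total surplus.
  ∑-excess : ∀ m v → ∑ E² (λ (m′ , v′) → solutions (m - m′) (v - v′) ∸ 1) ≡ excess
  ∑-excess m v = begin
    ∑ E² (λ (m′ , v′) → solutions (m - m′) (v - v′) ∸ 1)
      ≡⟨ ∑-E² _ ⟩
    ∑ E (λ m′ → ∑ E λ v′ → solutions (m - m′) (v - v′) ∸ 1)
      ≡⟨ ∑-cong E (λ m′ → ∑-reflect v (λ eq → ≡.cong (_∸ 1) (solutions-cong refl eq))) ⟩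
    ∑ E (λ m′ → ∑ E λ w → solutions (m - m′) w ∸ 1)
      ≡⟨ ∑-reflect m (λ eq → ∑-cong E λ w → ≡.cong (_∸ 1) (solutions-cong eq refl)) ⟩
    excess ∎
    where open ≡.≡-Reasoning

  incidence-bound :
    ∀ (P L : Carrier × Carrier → ℕ) → (∀ x → P x ≤ 1) → (∀ l → L l ≤ 1) →
    let I = ∑ E² λ x → P x ℕ.* ∑ E² λ l → L l ℕ.* incident x l
    in size ℕ.* I ≤ 2 ℕ.* (∑ E² P ℕ.* ∑ E² L) ⊎ I ℕ.* I ≤ 4 ℕ.* (∑ E² P ℕ.* ∑ E² L ℕ.* excess)
  incidence-bound P L P≤1 L≤1 =
    second-moment E² P ℓₚ size Λ excess {{Fin.nonZeroIndex (index 0#)}} P≤1 lengthE² mean moment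
    where
    ℓₚ : Carrier × Carrier → ℕ
    ℓₚ x = ∑ E² λ l → L l ℕ.* incident x l
    Λ : ℕ
    Λ = ∑ E² L

    lengthE² : length E² ≡ size ℕ.* size
    lengthE² = begin
      length E²                     ≡⟨ ℕ.*-identityʳ _ ⟨
      length E² ℕ.* 1               ≡⟨ ∑-const E² 1 ⟨
      ∑ E² (λ _ → 1)                ≡⟨ ∑-E² _ ⟩
      ∑ E (λ _ → ∑ E λ _ → 1)       ≡⟨ ∑-const E _ ⟩
      length E ℕ.* ∑ E (λ _ → 1)    ≡⟨ ≡.cong₂ ℕ._*_ length-E ∑-E-one ⟩
      size ℕ.* size                 ∎
      where open ≡.≡-Reasoning

    mean : ∑ E² ℓₚ ≡ Λ ℕ.* size
    mean = begin
      ∑ E² (λ x → ∑ E² λ l → L l ℕ.* incident x l)  ≡⟨ ∑-swap E² E² _ ⟩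
      ∑ E² (λ l → ∑ E² λ x → L l ℕ.* incident x l)  ≡⟨ ∑-cong E² (λ l →
                                                        ≡.trans (∑-distribˡ-* E² (L l) (λ x → incident x l)) (≡.cong (L l ℕ.*_) (points-on-line l))) ⟩
      ∑ E² (λ l → L l ℕ.* size)                     ≡⟨ ∑-distribʳ-* E² size L ⟩
      Λ ℕ.* size                                    ∎
      where open ≡.≡-Reasoning

    -- The one common point expected of a pair is split off. Summed over pairs of lines it gives
    -- `Λ²`, and only the surplus is charged to `excess`. The diagonal `l = l′` is included, as the
    -- difference `(0 , 0)`.
    pair-bound : ∀ l l′ → ∑ E² (λ x → incident x l ℕ.* incident x l′)
                   ≤ 1 ℕ.+ (solutions (proj₁ l - proj₁ l′) (proj₂ l - proj₂ l′) ∸ 1)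
    pair-bound (m , v) (m′ , v′) = ≤-trans (common-points m v m′ v′) (m≤n+m∸n _ 1)

    moment : ∑ E² (λ x → ℓₚ x ℕ.* ℓₚ x) ≤ Λ ℕ.* Λ ℕ.+ Λ ℕ.* excess
    moment = begin
      ∑ E² (λ x → ℓₚ x ℕ.* ℓₚ x)
        ≡⟨ ∑-cong E² (λ x → ≡.sym (∑-separate E² E² _ _)) ⟩
      ∑ E² (λ x → ∑ E² λ l → ∑ E² λ l′ → L l ℕ.* incident x l ℕ.* (L l′ ℕ.* incident x l′))
        ≡⟨ ∑-swap E² E² _ ⟩
      ∑ E² (λ l → ∑ E² λ x → ∑ E² λ l′ → L l ℕ.* incident x l ℕ.* (L l′ ℕ.* incident x l′))
        ≡⟨ ∑-cong E² (λ l → ∑-swap E² E² _) ⟩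
      ∑ E² (λ l → ∑ E² λ l′ → ∑ E² λ x → L l ℕ.* incident x l ℕ.* (L l′ ℕ.* incident x l′))
        ≡⟨ ∑-cong E² (λ l → ∑-cong E² λ l′ → ≡.trans
             (∑-cong E² λ x → regroup (L l) (incident x l) (L l′) (incident x l′))
             (∑-distribˡ-* E² (L l ℕ.* L l′) _)) ⟩
      ∑ E² (λ l → ∑ E² λ l′ → L l ℕ.* L l′ ℕ.* ∑ E² (λ x → incident x l ℕ.* incident x l′))
        ≤⟨ ∑-mono E² (λ l → ∑-mono E² λ l′ → weigh l l′) ⟩
      ∑ E² (λ l → ∑ E² λ l′ → L l ℕ.* L l′ ℕ.+ L l ℕ.* κ l l′)
        ≡⟨ ∑-cong E² (λ l → ∑-distrib-+ E² _ _) ⟩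
      ∑ E² (λ l → ∑ E² (λ l′ → L l ℕ.* L l′) ℕ.+ ∑ E² (λ l′ → L l ℕ.* κ l l′))
        ≡⟨ ∑-distrib-+ E² _ _ ⟩
      ∑ E² (λ l → ∑ E² (λ l′ → L l ℕ.* L l′)) ℕ.+ ∑ E² (λ l → ∑ E² (λ l′ → L l ℕ.* κ l l′))
        ≡⟨ ≡.cong₂ ℕ._+_ (∑-separate E² E² L L)
             (≡.trans (∑-cong E² λ l → ≡.trans (∑-distribˡ-* E² (L l) (κ l)) (≡.cong (L l ℕ.*_) (∑-excess _ _)))
               (∑-distribʳ-* E² excess L)) ⟩
      Λ ℕ.* Λ ℕ.+ Λ ℕ.* excess ∎
      where
      open ≤-Reasoning
      κ : Carrier × Carrier → Carrier × Carrier → ℕ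
      κ (m , v) (m′ , v′) = solutions (m - m′) (v - v′) ∸ 1
      regroup : ∀ a b c d → a ℕ.* b ℕ.* (c ℕ.* d) ≡ a ℕ.* c ℕ.* (b ℕ.* d)
      regroup = solve-∀
      distribute : ∀ a b k → a ℕ.* b ℕ.* (1 ℕ.+ k) ≡ a ℕ.* b ℕ.+ a ℕ.* b ℕ.* k
      distribute = solve-∀
      -- The factor `L l′ ≤ 1` is kept in the main term, where it yields `Λ²`, and dropped in the
      -- surplus, so that `l′` runs over all lines and `∑-excess` applies.
      weigh : ∀ l l′ → L l ℕ.* L l′ ℕ.* ∑ E² (λ x → incident x l ℕ.* incident x l′)
                ≤ L l ℕ.* L l′ ℕ.+ L l ℕ.* κ l l′
      weigh l l′ = begin
        L l ℕ.* L l′ ℕ.* ∑ E² (λ x → incident x l ℕ.* incident x l′)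
          ≤⟨ ℕ.*-monoʳ-≤ (L l ℕ.* L l′) (pair-bound l l′) ⟩
        L l ℕ.* L l′ ℕ.* (1 ℕ.+ κ l l′)
          ≡⟨ distribute (L l) (L l′) (κ l l′) ⟩
        L l ℕ.* L l′ ℕ.+ L l ℕ.* L l′ ℕ.* κ l l′
          ≤⟨ ℕ.+-monoʳ-≤ (L l ℕ.* L l′) (ℕ.*-monoˡ-≤ (κ l l′)
               (≤-trans (ℕ.*-monoʳ-≤ (L l) (L≤1 l′)) (≤-reflexive (ℕ.*-identityʳ (L l))))) ⟩
        L l ℕ.* L l′ ℕ.+ L l ℕ.* κ l l′ ∎

-- Multiples of powers of the uniformizer

module _ {a ℓ} (𝓡 : FiniteValuationRing a ℓ) where
  open FiniteValuationRing 𝓡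

  module UniformizerCounting
    {q r : ℕ} {z : Carrier} (uniformizer : IsUniformizer z)
    (nilpotency : HasNilpotencyDegree z r) (card : HasCardinality R/⟨ z ⟩ q)
    where

    open FiniteRingCounting finiteCommutativeRing
    open GroupProps +-group using (x≈y⇒x∙y⁻¹≈ε; x∙y⁻¹≈ε⇒x≈y)
    open RingProps ring using ([y-z]x≈yx-zx)
    open SemiringDivisibility semiring using (_,_; ∣-respʳ)
    import Relation.Binary.Reasoning.Setoid setoid as ≈-Reasoning
    private module Solver = SemiringSolver commutativeSemiring
    open Solver using (_:+_; _:*_; _:=_; con)

    -- The ideal generated by `x` and `z`, units and valuations

    Combination : Carrier → Carrier → Set _
    Combination x y = ∃₂ λ a b → a * x + b * z ≈ y

    combination? : ∀ x → Decidable (Combination x)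
    combination? x y = map′
      (λ (i , j , eq) → element i , element j , eq)
      (λ (a , b , eq) → index a , index b ,
        trans (+-cong (*-congʳ (element-index a)) (*-congʳ (element-index b))) eq)
      (Fin.any? λ i → Fin.any? λ j → element i * x + element j * z ≟ y)

    module _ (x : Carrier) where
      private
        J : Subset size
        J = ⟦ combination? x ⟧

      ∈J⁺ : ∀ {y} → Combination x y → y ∈ J
      ∈J⁺ (a , b , eq) = ∈⟦⟧⁺ (combination? x) (a , b , trans eq (sym (element-index _)))

      ∈J⁻ : ∀ {y} → y ∈ J → Combination x y
      ∈J⁻ {y} y∈J with combination? x (element (index y)) in eq
      ... | yes (a , b , e) = a , b , trans e (element-index y)
      ... | no  _ = contradiction
        (≡.trans (≡.sym ([]=⇒lookup y∈J)) (≡.trans (lookup∘tabulate _ (index y)) (≡.cong does eq)))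
        λ ()

      J-isIdeal : IsIdeal J
      J-isIdeal = record
        { 0∈       = ∈J⁺ (0# , 0# , Solver.solve 2 (λ x z → con 0 :* x :+ con 0 :* z := con 0) refl x z)
        ; +-closed = λ y∈J w∈J → let (a , b , e) = ∈J⁻ y∈J ; (a′ , b′ , e′) = ∈J⁻ w∈J in
            ∈J⁺ (a + a′ , b + b′ , trans
              (Solver.solve 6 (λ a b a′ b′ x z → (a :+ a′) :* x :+ (b :+ b′) :* z :=
                                                (a :* x :+ b :* z) :+ (a′ :* x :+ b′ :* z))
                refl a b a′ b′ x z)
              (+-cong e e′))
        ; *-closed = λ s y∈J → let (a , b , e) = ∈J⁻ y∈J in
            ∈J⁺ (s * a , s * b , trans
              (Solver.solve 5 (λ s a b x z → s :* a :* x :+ s :* b :* z := s :* (a :* x :+ b :* z))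
                refl s a b x z)
              (*-congˡ e))
        }

      -- The ideal `J = (x, z)` contains the maximal ideal generated by `z`. If it were proper,
      -- maximality would put `x` into that ideal.
      coprime-to-z : ¬ z ∣ x → Combination x 1#
      coprime-to-z z∤x with ≡-dec Bool._≟_ J ⊤
      ... | yes J≡⊤ = ∈J⁻ (≡.subst (1# ∈_) (≡.sym J≡⊤) ∈⊤)
      ... | no  J≢⊤ = contradiction
        (Equivalence.to (M≡⟨z⟩ x) (≡.subst (x ∈_) (≡.sym M≡J) x∈J)) z∤x
        where
        M = proj₁ (proj₂ uniformizer)
        M-maximal = proj₁ (proj₂ (proj₂ uniformizer))
        M≡⟨z⟩ = proj₂ (proj₂ (proj₂ uniformizer))
        x∈J : x ∈ J
        x∈J = ∈J⁺ (1# , 0# , Solver.solve 2 (λ x z → con 1 :* x :+ con 0 :* z := x) refl x z)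
        M⊆J : M Subset.⊆ J
        M⊆J {i} i∈M with Equivalence.to (M≡⟨z⟩ (element i)) (≡.subst (Subset._∈ M) (≡.sym (index-element i)) i∈M)
        ... | b , bz≈e = ≡.subst (Subset._∈ J) (index-element i)
          (∈J⁺ (0# , b , trans (Solver.solve 3 (λ b x z → con 0 :* x :+ b :* z := b :* z) refl b x z) bz≈e))
        M≡J : M ≡ J
        M≡J = IsMaximalIdeal.maximal M-maximal J J-isIdeal J≢⊤ M⊆J

      -- From a x + b z = 1, a geometric series in the nilpotent element b z inverts x.
      invert-∤ : ¬ z ∣ x → ∃ λ y → y * x ≈ 1#
      invert-∤ z∤x with coprime-to-z z∤x
      ... | a , b , ax+bz≈1 = let (c , d , e) = series r in c , (begin
        c * x              ≈⟨ Solver.solve 3 (λ c d x → c :* x := c :* x :+ d :* con 0) refl c d x ⟩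
        c * x + d * 0#     ≈⟨ +-congˡ (*-congˡ (sym (proj₁ nilpotency))) ⟩
        c * x + d * z ^ r  ≈⟨ e ⟩
        1#                 ∎)
        where
        open ≈-Reasoning
        series : ∀ k → ∃₂ λ c d → c * x + d * z ^ k ≈ 1#
        series zero    = 0# , 1# , Solver.solve 1 (λ x → con 0 :* x :+ con 1 :* con 1 := con 1) refl x
        series (suc k) with series k
        ... | c , d , e = c + d * z ^ k * a , d * b , (begin
          (c + d * z ^ k * a) * x + d * b * (z * z ^ k)
            ≈⟨ Solver.solve 7 (λ a b c d x z p →
                 (c :+ d :* p :* a) :* x :+ d :* b :* (z :* p) :=
                 c :* x :+ d :* p :* (a :* x :+ b :* z)) refl a b c d x z (z ^ k) ⟩
          c * x + d * z ^ k * (a * x + b * z)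
            ≈⟨ +-congˡ (*-congˡ ax+bz≈1) ⟩
          c * x + d * z ^ k * 1#
            ≈⟨ +-congˡ (*-identityʳ _) ⟩
          c * x + d * z ^ k
            ≈⟨ e ⟩
          1# ∎)

    infix 4 _∣?_
    _∣?_ : ∀ s y → Dec (s ∣ y)
    s ∣? y = map′ (λ (i , eq) → element i , eq)
      (λ (c , eq) → index c , trans (*-congʳ (element-index c)) eq)
      (Fin.any? λ i → element i * s ≟ y)

    -- Divide by `z` until the quotient is not divisible, hence a unit. If `r` divisions succeed,
    -- then `d = 0`, which is recorded as `1 z^r`; thus zero gets valuation `r`.
    valuation : ∀ d → ∃ λ k → k ≤ r × ∃₂ λ u v → v * u ≈ 1# × d ≈ u * z ^ k
    valuation d with search r ℕ.≤-refl
      where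
      search : ∀ j → j ≤ r → (∃ λ c → d ≈ c * z ^ j) ⊎ (∃ λ k → k ≤ r × ∃₂ λ u v → v * u ≈ 1# × d ≈ u * z ^ k)
      search zero    _     = inj₁ (d , sym (*-identityʳ d))
      search (suc j) j<r with search j (ℕ.<⇒≤ j<r)
      ... | inj₂ found = inj₂ found
      ... | inj₁ (c , d≈czʲ) with z ∣? c
      ...   | yes (b , bz≈c) = inj₁ (b , trans d≈czʲ (trans (*-congʳ (sym bz≈c)) (*-assoc b z _)))
      ...   | no  z∤c        = let (v , vc≈1) = invert-∤ c z∤c in inj₂ (j , ℕ.<⇒≤ j<r , c , v , vc≈1 , d≈czʲ)
    ... | inj₂ found       = found
    ... | inj₁ (c , d≈czʳ) = r , ℕ.≤-refl , 1# , 1# , *-identityˡ 1# , (begin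
      d             ≈⟨ d≈czʳ ⟩
      c * z ^ r     ≈⟨ *-congˡ (proj₁ nilpotency) ⟩
      c * 0#        ≈⟨ Solver.solve 1 (λ c → c :* con 0 := con 1 :* con 0) refl c ⟩
      1# * 0#       ≈⟨ *-congˡ (sym (proj₁ nilpotency)) ⟩
      1# * z ^ r    ∎)
      where open ≈-Reasoning

    -- The difference `x - e z` is killed by `z^k`. If `z` did not divide it, it would be a unit and
    -- `z^k` would vanish, against the minimality of `r`.
    ∣-cancel : ∀ {k} → k < r → ∀ {x e} → x * z ^ k ≈ e * z ^ suc k → z ∣ x
    ∣-cancel {k} k<r {x} {e} eq with z ∣? (x - e * z)
    ... | yes (c , cz≈) = c + e , (begin
      (c + e) * z    ≈⟨ distribʳ z c e ⟩
      c * z + e * z  ≈⟨ x-y≈w⇒x≈w+y (sym cz≈) ⟨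
      x              ∎)
      where open ≈-Reasoning
    ... | no z∤ = let (v , eq′) = invert-∤ _ z∤ in contradiction (begin
      z ^ k                        ≈⟨ *-identityˡ _ ⟨
      1# * z ^ k                   ≈⟨ *-congʳ eq′ ⟨
      v * (x - e * z) * z ^ k      ≈⟨ *-assoc _ _ _ ⟩
      v * ((x - e * z) * z ^ k)    ≈⟨ *-congˡ ([y-z]x≈yx-zx _ _ _) ⟩
      v * (x * z ^ k - e * z * z ^ k)
        ≈⟨ *-congˡ (x≈y⇒x∙y⁻¹≈ε (trans eq (sym (*-assoc e z _)))) ⟩
      v * 0#                       ≈⟨ zeroʳ v ⟩
      0#                           ∎) (proj₂ nilpotency k k<r)
      where open ≈-Reasoning

    private
      class : Carrier → Fin q
      class = Inverse.to card
      rep : Fin q → Carrier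
      rep = Inverse.from card

    -- Sizes of the ideals `z^k R` and of their annihilators

    multiple : ℕ → Carrier → ℕ
    multiple k y = 𝟙 (z ^ k ∣? y)

    multiple-resp : ∀ k → Respectful (multiple k)
    multiple-resp k {x} {y} x≈y = 𝟙-cong (z ^ k ∣? x) (z ^ k ∣? y) (∣-respʳ x≈y) (∣-respʳ (sym x≈y))

    -- z^k R is the disjoint union of the cosets z^k ρ + z^(k+1) R, one for each residue class ρ.
    refine : ∀ k → k < r → ∀ y → ∑ (allFin q) (λ i → multiple (suc k) (y - rep i * z ^ k)) ≡ multiple k y
    refine k k<r y with z ^ k ∣? y
    ... | no zᵏ∤y = ≡.trans (∑-cong (allFin q) λ i → 𝟙-no (z ^ suc k ∣? (y - rep i * z ^ k)) (impossible i))
      (≡.trans (∑-zero (allFin q)) (≡.sym (𝟙-no (z ^ k ∣? y) zᵏ∤y)))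
      where
      open ≈-Reasoning
      impossible : ∀ i → ¬ z ^ suc k ∣ (y - rep i * z ^ k)
      impossible i (e , eq) = zᵏ∤y (e * z + rep i , (begin
        (e * z + rep i) * z ^ k
          ≈⟨ Solver.solve 4 (λ e z s p → (e :* z :+ s) :* p := e :* (z :* p) :+ s :* p) refl e z (rep i) (z ^ k) ⟩
        e * z ^ suc k + rep i * z ^ k
          ≈⟨ x-y≈w⇒x≈w+y (sym eq) ⟨
        y ∎))
    ... | yes (c , czᵏ≈y) = ≡.trans
      (∑-tabulate-single id (λ i → multiple (suc k) (y - rep i * z ^ k)) (class c) λ i i≢ →
        𝟙-no (z ^ suc k ∣? (y - rep i * z ^ k)) (i≢ ∘ same-class i))
      (≡.trans (𝟙-yes (z ^ suc k ∣? (y - rep (class c) * z ^ k)) divides-own)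
        (≡.sym (𝟙-yes (z ^ k ∣? y) (c , czᵏ≈y))))
      where
      open ≈-Reasoning
      factor : ∀ i → (c - rep i) * z ^ k ≈ y - rep i * z ^ k
      factor i = trans ([y-z]x≈yx-zx _ _ _) (+-congʳ czᵏ≈y)
      same-class : ∀ i → z ^ suc k ∣ (y - rep i * z ^ k) → i ≡ class c
      same-class i (e , eq) = ≡.sym (≡.trans
        (Inverse.to-cong card (∣-cancel k<r (trans (factor i) (sym eq))))
        (Inverse.strictlyInverseˡ card i))
      divides-own : z ^ suc k ∣ (y - rep (class c) * z ^ k)
      divides-own with Setoid.sym R/⟨ z ⟩ {rep (class c)} {c} (Inverse.strictlyInverseʳ card c)
      ... | e , eq = e , (begin
        e * (z * z ^ k)              ≈⟨ *-assoc e z _ ⟨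
        e * z * z ^ k                ≈⟨ *-congʳ eq ⟩
        (c - rep (class c)) * z ^ k  ≈⟨ factor _ ⟩
        y - rep (class c) * z ^ k    ∎)

    multiples : ℕ → ℕ
    multiples k = ∑ E (multiple k)

    multiples-suc : ∀ k → k < r → multiples k ≡ q ℕ.* multiples (suc k)
    multiples-suc k k<r = begin
      ∑ E (multiple k)
        ≡⟨ ∑-cong E (λ y → ≡.sym (refine k k<r y)) ⟩
      ∑ E (λ y → ∑ (allFin q) λ i → multiple (suc k) (y - rep i * z ^ k))
        ≡⟨ ∑-swap E (allFin q) _ ⟩
      ∑ (allFin q) (λ i → ∑ E λ y → multiple (suc k) (y - rep i * z ^ k))
        ≡⟨ ∑-cong (allFin q) (λ i → ∑-translate _ (multiple-resp (suc k))) ⟩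
      ∑ (allFin q) (λ _ → multiples (suc k))
        ≡⟨ ∑-const (allFin q) _ ⟩
      length (allFin q) ℕ.* multiples (suc k)
        ≡⟨ ≡.cong (ℕ._* multiples (suc k)) (length-tabulate {n = q} id) ⟩
      q ℕ.* multiples (suc k) ∎
      where open ≡.≡-Reasoning

    -- The induction climbs the chain of ideals from `z^r R = 0`, where `j = 0`, gaining a factor
    -- `q` at each step.
    multiples≡q^ : ∀ j k → j ℕ.+ k ≡ r → multiples k ≡ q ℕ.^ j
    multiples≡q^ zero    k ≡.refl = ∑-unique (z ^ k ∣?_) 0#
      (λ y y≈0 → 0# , trans (zeroˡ _) (sym y≈0))
      (λ y (e , eq) → trans (sym eq) (trans (*-congˡ (proj₁ nilpotency)) (zeroʳ e)))
    multiples≡q^ (suc j) k ≡.refl = ≡.trans (multiples-suc k (s≤s (ℕ.m≤n+m k j)))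
      (≡.cong (q ℕ.*_) (multiples≡q^ j (suc k) (ℕ.+-suc j k)))

    size≡qʳ : size ≡ q ℕ.^ r
    size≡qʳ = ≡.trans
      (≡.trans (≡.sym ∑-E-one) (∑-cong E λ y → ≡.sym (𝟙-yes (z ^ 0 ∣? y) (y , *-identityʳ y))))
      (multiples≡q^ r 0 (ℕ.+-identityʳ r))

    -- The solution set is the coset of the annihilator of `d` through `x₀`.
    solutions-homogeneous : ∀ {d w} x₀ → x₀ * d ≈ w → solutions d w ≡ solutions d 0#
    solutions-homogeneous {d} {w} x₀ x₀d≈w = ≡.trans
      (∑-cong E λ x → 𝟙-cong (x * d ≟ w) ((x - x₀) * d ≟ 0#)
        (λ xd≈w → trans ([y-z]x≈yx-zx _ _ _) (x≈y⇒x∙y⁻¹≈ε (trans xd≈w (sym x₀d≈w))))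
        (λ eq → trans (x∙y⁻¹≈ε⇒x≈y _ _ (trans (sym ([y-z]x≈yx-zx _ _ _)) eq)) x₀d≈w))
      (∑-translate x₀ λ {x} {y} x≈y → 𝟙-cong (x * d ≟ 0#) (y * d ≟ 0#)
        (trans (*-congʳ (sym x≈y))) (trans (*-congʳ x≈y)))

    solutions-unit : ∀ {d u v} s → v * u ≈ 1# → d ≈ u * s → solutions d 0# ≡ solutions s 0#
    solutions-unit {d} {u} {v} s vu≈1 d≈us = ∑-cong E λ x → 𝟙-cong (x * d ≟ 0#) (x * s ≟ 0#)
      (λ xd≈0 → begin
        x * s            ≈⟨ *-identityˡ _ ⟨
        1# * (x * s)     ≈⟨ *-congʳ vu≈1 ⟨
        v * u * (x * s)  ≈⟨ Solver.solve 4 (λ v u x s → v :* u :* (x :* s) := v :* (x :* (u :* s))) refl v u x s ⟩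
        v * (x * (u * s)) ≈⟨ *-congˡ (*-congˡ d≈us) ⟨
        v * (x * d)      ≈⟨ *-congˡ xd≈0 ⟩
        v * 0#           ≈⟨ zeroʳ v ⟩
        0#               ∎)
      (λ xs≈0 → begin
        x * d            ≈⟨ *-congˡ d≈us ⟩
        x * (u * s)      ≈⟨ Solver.solve 3 (λ u x s → x :* (u :* s) := u :* (x :* s)) refl u x s ⟩
        u * (x * s)      ≈⟨ *-congˡ xs≈0 ⟩
        u * 0#           ≈⟨ zeroʳ u ⟩
        0#               ∎)
      where open ≈-Reasoning

    private instance
      q≢0 : NonZero q
      q≢0 = residueCardinality-nonZero card

    -- Both sides of q^j · |ann(z^k)| = q^r count R, the left one along the fibres of x ↦ x z^k.
    annihilator : ∀ {k} → k ≤ r → solutions (z ^ k) 0# ≡ q ℕ.^ k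
    annihilator {k} k≤r = ℕ.*-cancelˡ-≡ _ _ (q ℕ.^ j) {{ℕ.m^n≢0 q j}} (begin
      q ℕ.^ j ℕ.* solutions (z ^ k) 0#
        ≡⟨ ≡.cong (ℕ._* _) (multiples≡q^ j k (ℕ.m∸n+n≡m k≤r)) ⟨
      multiples k ℕ.* solutions (z ^ k) 0#
        ≡⟨ ∑-distribʳ-* E _ (multiple k) ⟨
      ∑ E (λ w → multiple k w ℕ.* solutions (z ^ k) 0#)
        ≡⟨ ∑-cong E fibre-size ⟩
      ∑ E (solutions (z ^ k))
        ≡⟨ ∑-swap E E _ ⟩
      ∑ E (λ x → ∑ E λ w → 𝟙 (x * z ^ k ≟ w))
        ≡⟨ ∑-cong E (λ x → ∑-unique (x * z ^ k ≟_) (x * z ^ k) (λ _ → sym) (λ _ → sym)) ⟩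
      ∑ E (λ _ → 1)
        ≡⟨ ∑-E-one ⟩
      size
        ≡⟨ size≡qʳ ⟩
      q ℕ.^ r
        ≡⟨ ≡.cong (q ℕ.^_) (ℕ.m∸n+n≡m k≤r) ⟨
      q ℕ.^ (j ℕ.+ k)
        ≡⟨ ℕ.^-distribˡ-+-* q j k ⟩
      q ℕ.^ j ℕ.* q ℕ.^ k ∎)
      where
      open ≡.≡-Reasoning
      j = r ∸ k
      fibre-size : ∀ w → multiple k w ℕ.* solutions (z ^ k) 0# ≡ solutions (z ^ k) w
      fibre-size w with z ^ k ∣? w
      ... | yes (x₀ , eq) = ≡.trans (≡.cong (ℕ._* _) (𝟙-yes (z ^ k ∣? w) (x₀ , eq)))
        (≡.trans (ℕ.*-identityˡ _) (≡.sym (solutions-homogeneous x₀ eq)))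
      ... | no  ∤w        = ≡.trans (≡.cong (ℕ._* _) (𝟙-no (z ^ k ∣? w) ∤w)) (≡.sym (≡.trans (∑-cong E λ x → 𝟙-no (x * z ^ k ≟ w) λ eq → ∤w (x , eq)) (∑-zero E)))

    -- With `k = i + 1`, this is `q^k` on the pairs with both entries in `z^k R`. Unlike the exact
    -- solution count, it factors in `d` and `w`, so the two sums separate.
    layer : Carrier → Carrier → Fin r → ℕ
    layer d w i = q ℕ.^ suc (toℕ i) ℕ.* (multiple (suc (toℕ i)) d ℕ.* multiple (suc (toℕ i)) w)

    -- Let `x₀ d = w` and `d = u z^k`. The solutions form a coset of the annihilator of `z^k`, which
    -- has `q^k` elements, and `w` is a multiple of `z^k` as well. Hence layer `k` alone covers the
    -- surplus.
    solutions∸1≤ : ∀ d w → solutions d w ∸ 1 ≤ ∑ (allFin r) (layer d w)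
    solutions∸1≤ d w with ∑-zero⊎witness E (λ x → 𝟙 (x * d ≟ w))
    ... | inj₁ none rewrite none = z≤n
    ... | inj₂ (x₀ , x₀∈) with valuation d
    ...   | k , k≤r , u , v , vu≈1 , d≈uzᵏ = begin
      solutions d w ∸ 1               ≡⟨ ≡.cong (_∸ 1) (≡.trans (solutions-homogeneous x₀ x₀d≈w)
                                           (≡.trans (solutions-unit (z ^ k) vu≈1 d≈uzᵏ) (annihilator k≤r))) ⟩
      q ℕ.^ k ∸ 1                     ≤⟨ layer-bound k k≤r d≈uzᵏ ⟩
      ∑ (allFin r) (layer d w)        ∎
      where
      open ≤-Reasoning
      x₀d≈w : x₀ * d ≈ w
      x₀d≈w = 𝟙-true (x₀ * d ≟ w) x₀∈
      layer-bound : ∀ k → k ≤ r → d ≈ u * z ^ k → q ℕ.^ k ∸ 1 ≤ ∑ (allFin r) (layer d w)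
      -- A unit `d` leaves exactly one solution and no surplus. So the layers may start at `k = 1`;
      -- a layer `k = 0` would add `q^(2r)`.
      layer-bound zero    _   _  = z≤n
      layer-bound (suc k) k<r eq = begin
        q ℕ.^ suc k ∸ 1             ≤⟨ ℕ.m∸n≤m _ 1 ⟩
        q ℕ.^ suc k                 ≡⟨ ℕ.*-identityʳ _ ⟨
        q ℕ.^ suc k ℕ.* 1           ≡⟨ ≡.cong₂ (λ m n → q ℕ.^ suc k ℕ.* (m ℕ.* n))
                                         (𝟙-yes (z ^ suc k ∣? d) (u , sym eq))
                                         (𝟙-yes (z ^ suc k ∣? w) (x₀ * u , trans (*-assoc x₀ u _)
                                           (trans (*-congˡ (sym eq)) x₀d≈w))) ⟨
        q ℕ.^ suc k ℕ.* (multiple (suc k) d ℕ.* multiple (suc k) w)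
                                    ≡⟨ ≡.cong (λ k → q ℕ.^ suc k ℕ.* (multiple (suc k) d ℕ.* multiple (suc k) w))
                                         (Fin.toℕ-fromℕ< k<r) ⟨
        layer d w (fromℕ< k<r)      ≤⟨ term≤∑ (layer d w) (∈-allFin (fromℕ< k<r)) ⟩
        ∑ (allFin r) (layer d w)    ∎

    -- Layer `k` sums to `q^k (q^(r-k))² = q^(2r-k)`; the value at `k = 1` bounds each of the `r`
    -- layers.
    excess-bound : excess ≤ r ℕ.* q ℕ.^ (2 ℕ.* r ∸ 1)
    excess-bound = begin
      excess
        ≤⟨ ∑-mono E (λ d → ∑-mono E λ w → solutions∸1≤ d w) ⟩
      ∑ E (λ d → ∑ E λ w → ∑ (allFin r) (layer d w))
        ≡⟨ ∑-cong E (λ d → ∑-swap E (allFin r) _) ⟩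
      ∑ E (λ d → ∑ (allFin r) λ i → ∑ E λ w → layer d w i)
        ≡⟨ ∑-swap E (allFin r) _ ⟩
      ∑ (allFin r) (λ i → ∑ E λ d → ∑ E λ w → layer d w i)
        ≤⟨ ∑-mono (allFin r) layer-sum ⟩
      ∑ (allFin r) (λ _ → q ℕ.^ (2 ℕ.* r ∸ 1))
        ≡⟨ ≡.trans (∑-const (allFin r) _) (≡.cong (ℕ._* q ℕ.^ (2 ℕ.* r ∸ 1)) (length-tabulate {n = r} id)) ⟩
      r ℕ.* q ℕ.^ (2 ℕ.* r ∸ 1) ∎
      where
      open ≤-Reasoning
      exponent : ∀ j k → j ℕ.+ suc k ≡ r → suc k ℕ.+ (j ℕ.+ j) ≤ 2 ℕ.* r ∸ 1
      exponent j k ≡.refl = ≤-trans (ℕ.m≤m+n _ k) (≤-reflexive (≡.sym (≡.cong (_∸ 1) (double j k))))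
        where
        double : ∀ j k → 2 ℕ.* (j ℕ.+ suc k) ≡ suc (suc k ℕ.+ (j ℕ.+ j) ℕ.+ k)
        double = solve-∀
      layer-sum : ∀ i → ∑ E (λ d → ∑ E λ w → layer d w i) ≤ q ℕ.^ (2 ℕ.* r ∸ 1)
      layer-sum i = begin
        ∑ E (λ d → ∑ E λ w → q ℕ.^ suc k ℕ.* (multiple (suc k) d ℕ.* multiple (suc k) w))
          ≡⟨ ∑-cong E (λ d → ∑-distribˡ-* E (q ℕ.^ suc k) _) ⟩
        ∑ E (λ d → q ℕ.^ suc k ℕ.* ∑ E λ w → multiple (suc k) d ℕ.* multiple (suc k) w)
          ≡⟨ ∑-distribˡ-* E (q ℕ.^ suc k) _ ⟩
        q ℕ.^ suc k ℕ.* ∑ E (λ d → ∑ E λ w → multiple (suc k) d ℕ.* multiple (suc k) w)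
          ≡⟨ ≡.cong (q ℕ.^ suc k ℕ.*_) (∑-separate E E _ _) ⟩
        q ℕ.^ suc k ℕ.* (multiples (suc k) ℕ.* multiples (suc k))
          ≡⟨ ≡.cong (λ m → q ℕ.^ suc k ℕ.* (m ℕ.* m)) (multiples≡q^ j (suc k) j+1+k≡r) ⟩
        q ℕ.^ suc k ℕ.* (q ℕ.^ j ℕ.* q ℕ.^ j)
          ≡⟨ ≡.cong (q ℕ.^ suc k ℕ.*_) (ℕ.^-distribˡ-+-* q j j) ⟨
        q ℕ.^ suc k ℕ.* q ℕ.^ (j ℕ.+ j)
          ≡⟨ ℕ.^-distribˡ-+-* q (suc k) (j ℕ.+ j) ⟨
        q ℕ.^ (suc k ℕ.+ (j ℕ.+ j))
          ≤⟨ ℕ.^-monoʳ-≤ q (exponent j k j+1+k≡r) ⟩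
        q ℕ.^ (2 ℕ.* r ∸ 1) ∎
        where
        k = toℕ i
        j = r ∸ suc k
        j+1+k≡r : j ℕ.+ suc k ≡ r
        j+1+k≡r = ℕ.m∸n+n≡m (Fin.toℕ<n i)

-- Incidences produced by triples

-- Here `t`, `u`, `v`, `c` are the sizes of `f(A,B)`, `A · C`, `B · C`, `C`, and `k` is `K`. Lines
-- cost `K²` and the passage from triples to incidences costs `K`, squared in the second case: hence
-- `K³` and `K⁴`.
incidences⇒expansion : ∀ k n N I Π Λ e t u v c → N ≤ k ℕ.* I → Π ≤ u ℕ.* t → Λ ≤ v ℕ.* (c ℕ.* (k ℕ.* k)) →
  n ℕ.* I ≤ 2 ℕ.* (Π ℕ.* Λ) ⊎ I ℕ.* I ≤ 4 ℕ.* (Π ℕ.* Λ ℕ.* e) →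
  n ℕ.* N ≤ 2 ℕ.* (k ℕ.* k ℕ.* k) ℕ.* (t ℕ.* u ℕ.* v ℕ.* c)
  ⊎ N ℕ.* N ≤ 4 ℕ.* (k ℕ.* k ℕ.* k ℕ.* k) ℕ.* (t ℕ.* u ℕ.* v ℕ.* c) ℕ.* e
incidences⇒expansion k n N I Π Λ e t u v c N≤ Π≤ Λ≤ (inj₁ few) = inj₁ (begin
  n ℕ.* N                                                ≤⟨ ℕ.*-monoʳ-≤ n N≤ ⟩
  n ℕ.* (k ℕ.* I)                                        ≡⟨ r₁ n k I ⟩
  k ℕ.* (n ℕ.* I)                                        ≤⟨ ℕ.*-monoʳ-≤ k (≤-trans few (ℕ.*-monoʳ-≤ 2 (ℕ.*-mono-≤ Π≤ Λ≤))) ⟩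
  k ℕ.* (2 ℕ.* (u ℕ.* t ℕ.* (v ℕ.* (c ℕ.* (k ℕ.* k)))))  ≡⟨ r₂ k u t v c ⟩
  2 ℕ.* (k ℕ.* k ℕ.* k) ℕ.* (t ℕ.* u ℕ.* v ℕ.* c)        ∎)
  where
  open ≤-Reasoning
  r₁ : ∀ s k i → s ℕ.* (k ℕ.* i) ≡ k ℕ.* (s ℕ.* i)
  r₁ = solve-∀
  r₂ : ∀ k u t v c → k ℕ.* (2 ℕ.* (u ℕ.* t ℕ.* (v ℕ.* (c ℕ.* (k ℕ.* k))))) ≡
                     2 ℕ.* (k ℕ.* k ℕ.* k) ℕ.* (t ℕ.* u ℕ.* v ℕ.* c)
  r₂ = solve-∀
incidences⇒expansion k n N I Π Λ e t u v c N≤ Π≤ Λ≤ (inj₂ many) = inj₂ (begin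
  N ℕ.* N                    ≤⟨ ℕ.*-mono-≤ N≤ N≤ ⟩
  k ℕ.* I ℕ.* (k ℕ.* I)      ≡⟨ r₁ k I ⟩
  k ℕ.* k ℕ.* (I ℕ.* I)      ≤⟨ ℕ.*-monoʳ-≤ (k ℕ.* k) (≤-trans many (ℕ.*-monoʳ-≤ 4
                                  (ℕ.*-monoˡ-≤ e (ℕ.*-mono-≤ Π≤ Λ≤)))) ⟩
  k ℕ.* k ℕ.* (4 ℕ.* (u ℕ.* t ℕ.* (v ℕ.* (c ℕ.* (k ℕ.* k))) ℕ.* e))    ≡⟨ r₂ k u t v c e ⟩
  4 ℕ.* (k ℕ.* k ℕ.* k ℕ.* k) ℕ.* (t ℕ.* u ℕ.* v ℕ.* c) ℕ.* e          ∎)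
  where
  open ≤-Reasoning
  r₁ : ∀ k i → k ℕ.* i ℕ.* (k ℕ.* i) ≡ k ℕ.* k ℕ.* (i ℕ.* i)
  r₁ = solve-∀
  r₂ : ∀ k u t v c e → k ℕ.* k ℕ.* (4 ℕ.* (u ℕ.* t ℕ.* (v ℕ.* (c ℕ.* (k ℕ.* k))) ℕ.* e)) ≡
                       4 ℕ.* (k ℕ.* k ℕ.* k ℕ.* k) ℕ.* (t ℕ.* u ℕ.* v ℕ.* c) ℕ.* e
  r₂ = solve-∀

module _ {a ℓ} (R : FiniteCommutativeRing a ℓ) where
  open FiniteCommutativeRing R hiding (_∣_)

  module TripleCounting
    (G : UnitSubgroup) (g h : Func ⟨ UnitSubgroup.set G ⟩ Rˣ.setoid) {K : ℕ}
    (g-ratios : ∀ w → ∣ range (UnitSubgroup.set G) (UnitSubgroup.ratio G g w) ∣ ≤ K)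
    (h-ratios : ∀ w → ∣ range (UnitSubgroup.set G) (UnitSubgroup.ratio G h w) ∣ ≤ K)
    (φ-fibres : ∀ u → μ (UnitSubgroup.set G) (UnitSubgroup.φ G g h u) ≤ K)
    (A B C : Subset size)
    (A⊆G : A ⊆ UnitSubgroup.set G) (B⊆G : B ⊆ UnitSubgroup.set G) (C⊆G : C ⊆ UnitSubgroup.set G)
    where

    open UnitSubgroup G

    open FiniteRingCounting R
    import Relation.Binary.Reasoning.Setoid setoid as ≈-Reasoning
    private
      module Solver = SemiringSolver commutativeSemiring
      module g = Func g
      module h = Func h
    open Solver using (_:+_; _:*_; _:=_)

    E³ : List (Carrier × Carrier × Carrier)
    E³ = cartesianProduct E E²

    _∈ᵣ?_ : ∀ x S → Dec (x ∈ S)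
    x ∈ᵣ? S = index x ∈? S

    unit-cancel : ∀ {u x y} → IsUnit u → x * u ≈ y * u → x ≈ y
    unit-cancel {u} {x} {y} (v , _ , uv≈1) xu≈yu = begin
      x            ≈⟨ *-identityʳ x ⟨
      x * 1#       ≈⟨ *-congˡ uv≈1 ⟨
      x * (u * v)  ≈⟨ *-assoc x u v ⟨
      x * u * v    ≈⟨ *-congʳ xu≈yu ⟩
      y * u * v    ≈⟨ *-assoc y u v ⟩
      y * (u * v)  ≈⟨ *-congˡ uv≈1 ⟩
      y * 1#       ≈⟨ *-identityʳ y ⟩
      y            ∎
      where open ≈-Reasoning

    -- Sums run over the whole ring, so `g` and `h` are extended by 1 outside `G`. The values stay
    -- units, and multiplication by them permutes the ring for every argument.
    extend : Func ⟨ set ⟩ Rˣ.setoid → Carrier → Rˣ.Carrier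
    extend k x with x ∈ᵣ? set
    ... | yes x∈G = Func.to k (x , x∈G)
    ... | no  _   = Rˣ.ε

    extend-∈ : ∀ k {x y} (y∈G : y ∈ set) → x ≈ y → proj₁ (extend k x) ≈ proj₁ (Func.to k (y , y∈G))
    extend-∈ k {x} y∈G x≈y with x ∈ᵣ? set
    ... | yes x∈G = Func.cong k x≈y
    ... | no  x∉G = contradiction (∈-resp (sym x≈y) y∈G) x∉G

    ĝ ĥ : Carrier → Carrier
    ĝ = proj₁ ∘ extend g
    ĥ = proj₁ ∘ extend h

    ĝ-unit : ∀ x → IsUnit (ĝ x)
    ĝ-unit = proj₂ ∘ extend g

    ĥ-unit : ∀ x → IsUnit (ĥ x)
    ĥ-unit = proj₂ ∘ extend h

    *-unit : ∀ {x y} → IsUnit x → IsUnit y → IsUnit (x * y)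
    *-unit x-unit y-unit = proj₂ ((_ , x-unit) Rˣ.∙ (_ , y-unit))

    T : Subset size
    T = image₂ (f g h) A⊆G B⊆G

    ∈-T⁺ : (x : Elem A) (y : Elem B) → ∀ {t} →
           Func.to (f g h) (include A⊆G x , include B⊆G y) ≈ t → t ∈ T
    ∈-T⁺ = ∈-range₂⁺ A B record
      { to   = λ (x , y) → Func.to (f g h) (include A⊆G x , include B⊆G y)
      ; cong = Func.cong (f g h)
      }

    -- The points and lines attached to `A`, `B` and `C`

    point : Carrier × Carrier → ℕ
    point (X , Y) = 𝟙 (Y ∈ᵣ? (A · C)) ℕ.* 𝟙 ((X * ĝ Y) ∈ᵣ? T)

    point≤1 : ∀ p → point p ≤ 1
    point≤1 (X , Y) = ℕ.*-mono-≤ (𝟙≤1 (Y ∈ᵣ? (A · C))) (𝟙≤1 ((X * ĝ Y) ∈ᵣ? T))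

    -- For each `Y`, multiplication by the unit `ĝ Y` carries the admissible `X` bijectively onto
    -- `T`.
    ∑-point : ∑ E² point ≡ ∣ A · C ∣ ℕ.* ∣ T ∣
    ∑-point = begin
      ∑ E² point
        ≡⟨ ≡.trans (∑-E² point) (∑-swap E E _) ⟩
      ∑ E (λ Y → ∑ E λ X → 𝟙 (Y ∈ᵣ? (A · C)) ℕ.* 𝟙 ((X * ĝ Y) ∈ᵣ? T))
        ≡⟨ ∑-cong E (λ Y → ≡.trans (∑-distribˡ-* E (𝟙 (Y ∈ᵣ? (A · C))) _)
             (≡.cong (𝟙 (Y ∈ᵣ? (A · C)) ℕ.*_)
               (≡.trans (∑-scale (ĝ Y) _ (proj₂ (proj₂ (ĝ-unit Y))) (𝟙∈-resp T)) (≡.sym (∣A∣≡∑ T))))) ⟩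
      ∑ E (λ Y → 𝟙 (Y ∈ᵣ? (A · C)) ℕ.* ∣ T ∣)
        ≡⟨ ∑-distribʳ-* E ∣ T ∣ _ ⟩
      ∑ E (λ Y → 𝟙 (Y ∈ᵣ? (A · C))) ℕ.* ∣ T ∣
        ≡⟨ ≡.cong (ℕ._* ∣ T ∣) (∣A∣≡∑ (A · C)) ⟨
      ∣ A · C ∣ ℕ.* ∣ T ∣ ∎
      where open ≡.≡-Reasoning

    -- `ratio` requires a proof that `w` lies in `G`; the default 0 elsewhere keeps the total over
    -- `κ` below `K` for every `w`.
    isRatio : Func ⟨ set ⟩ Rˣ.setoid → Carrier → Carrier → ℕ
    isRatio k w κ with w ∈ᵣ? set
    ... | yes w∈G = 𝟙 (κ ∈ᵣ? range set (ratio k (w , w∈G)))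
    ... | no  _   = 0

    ∑-isRatio : ∀ k → (∀ w → ∣ range set (ratio k w) ∣ ≤ K) → ∀ w → ∑ E (isRatio k w) ≤ K
    ∑-isRatio k bound w with w ∈ᵣ? set
    ... | yes w∈G = ≤-trans (≤-reflexive (≡.sym (∣A∣≡∑ _))) (bound (w , w∈G))
    ... | no  _   = ≤-trans (≤-reflexive (∑-zero E)) z≤n

    isRatio⁺ : ∀ k {w w′ x κ} (w∈G : w ∈ set) (x∈G : x ∈ set) (xw∈G : x * w ∈ set) → w′ ≈ w →
               κ * proj₁ (Func.to k (x , x∈G)) ≈ proj₁ (Func.to k (x * w , xw∈G)) → isRatio k w′ κ ≡ 1
    isRatio⁺ k {w} {w′} {x} {κ} w∈G x∈G xw∈G w′≈w κkx≈kxw with w′ ∈ᵣ? set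
    ... | no  w′∉G = contradiction (∈-resp (sym w′≈w) w∈G) w′∉G
    ... | yes w′∈G = 𝟙-yes (κ ∈ᵣ? range set (ratio k (w′ , w′∈G)))
      (∈-range⁺ set (ratio k (w′ , w′∈G)) (x , x∈G) (unit-cancel (_ , x⁻¹x , xx⁻¹) (begin
        kxw′ * x⁻¹ * kx    ≈⟨ *-assoc _ _ _ ⟩
        kxw′ * (x⁻¹ * kx)  ≈⟨ *-congˡ x⁻¹x ⟩
        kxw′ * 1#          ≈⟨ *-identityʳ _ ⟩
        kxw′               ≈⟨ Func.cong k (*-congˡ w′≈w) ⟩
        proj₁ (Func.to k (x * w , xw∈G)) ≈⟨ κkx≈kxw ⟨
        κ * kx             ∎)))
      where
      open ≈-Reasoning
      kx = proj₁ (Func.to k (x , x∈G))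
      x⁻¹ = proj₁ (proj₂ (Func.to k (x , x∈G)))
      x⁻¹x = proj₁ (proj₂ (proj₂ (Func.to k (x , x∈G))))
      xx⁻¹ = proj₂ (proj₂ (proj₂ (Func.to k (x , x∈G))))
      kxw′ = proj₁ (Func.to k ((x , x∈G) ∙ (w′ , w′∈G)))

    -- Marks a representation `s = w κ κ′` with `w` in `C`, `κ` a value of `g(xw)/g(x)` and `κ′` a
    -- value of `h(yw)/h(y)`. Each of the at most `|C| K²` such triples represents one `s`.
    slope : Carrier → Carrier × Carrier × Carrier → ℕ
    slope s (w , κ , κ′) = 𝟙 (w ∈ᵣ? C) ℕ.* (isRatio g w κ ℕ.* (isRatio h w κ′ ℕ.* 𝟙 (s ≟ w * κ * κ′)))

    slopes : Carrier → ℕ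
    slopes s = ∑ E³ (slope s)

    slopes-resp : Respectful slopes
    slopes-resp {s} {s′} s≈s′ = ∑-cong E³ λ (w , κ , κ′) →
      ≡.cong (λ n → 𝟙 (w ∈ᵣ? C) ℕ.* (isRatio g w κ ℕ.* (isRatio h w κ′ ℕ.* n)))
        (𝟙-cong (s ≟ w * κ * κ′) (s′ ≟ w * κ * κ′) (trans (sym s≈s′)) (trans s≈s′))

    ∑-slopes : ∑ E slopes ≤ ∣ C ∣ ℕ.* (K ℕ.* K)
    ∑-slopes = begin
      ∑ E (λ s → ∑ E³ (slope s))
        ≡⟨ ∑-swap E E³ slope ⟩
      ∑ E³ (λ t → ∑ E λ s → slope s t)
        ≡⟨ ∑-cong E³ per-triple ⟩
      ∑ E³ (λ (w , κ , κ′) → 𝟙 (w ∈ᵣ? C) ℕ.* (isRatio g w κ ℕ.* isRatio h w κ′))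
        ≡⟨ ∑-cartesianProduct E E² _ ⟩
      ∑ E (λ w → ∑ E² λ (κ , κ′) → 𝟙 (w ∈ᵣ? C) ℕ.* (isRatio g w κ ℕ.* isRatio h w κ′))
        ≡⟨ ∑-cong E (λ w → ≡.trans (∑-distribˡ-* E² (𝟙 (w ∈ᵣ? C)) _)
             (≡.cong (𝟙 (w ∈ᵣ? C) ℕ.*_) (≡.trans (∑-E² _) (∑-separate E E _ _)))) ⟩
      ∑ E (λ w → 𝟙 (w ∈ᵣ? C) ℕ.* (∑ E (isRatio g w) ℕ.* ∑ E (isRatio h w)))
        ≤⟨ ∑-mono E (λ w → ℕ.*-monoʳ-≤ (𝟙 (w ∈ᵣ? C))
             (ℕ.*-mono-≤ (∑-isRatio g g-ratios w) (∑-isRatio h h-ratios w))) ⟩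
      ∑ E (λ w → 𝟙 (w ∈ᵣ? C) ℕ.* (K ℕ.* K))
        ≡⟨ ∑-distribʳ-* E (K ℕ.* K) _ ⟩
      ∑ E (λ w → 𝟙 (w ∈ᵣ? C)) ℕ.* (K ℕ.* K)
        ≡⟨ ≡.cong (ℕ._* (K ℕ.* K)) (∣A∣≡∑ C) ⟨
      ∣ C ∣ ℕ.* (K ℕ.* K) ∎
      where
      open ≤-Reasoning
      per-triple : ∀ t → ∑ E (λ s → slope s t) ≡
        (let (w , κ , κ′) = t in 𝟙 (w ∈ᵣ? C) ℕ.* (isRatio g w κ ℕ.* isRatio h w κ′))
      per-triple (w , κ , κ′) = ≡.trans (∑-distribˡ-* E (𝟙 (w ∈ᵣ? C)) _) (≡.cong (𝟙 (w ∈ᵣ? C) ℕ.*_)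
        (≡.trans (∑-distribˡ-* E (isRatio g w κ) _) (≡.cong (isRatio g w κ ℕ.*_)
        (≡.trans (∑-distribˡ-* E (isRatio h w κ′) _) (≡.trans (≡.cong (isRatio h w κ′ ℕ.*_)
          (∑-unique (_≟ w * κ * κ′) (w * κ * κ′) (λ _ → id) (λ _ → id))) (ℕ.*-identityʳ _))))))

    -- The minimum with 1 counts a normalised slope `m h(v)` once, however many representations it
    -- has.
    line : Carrier × Carrier → ℕ
    line (m , v) = 𝟙 (v ∈ᵣ? (B · C)) ℕ.* (1 ℕ.⊓ slopes (m * ĥ v))

    line≤1 : ∀ l → line l ≤ 1
    line≤1 (m , v) = ℕ.*-mono-≤ (𝟙≤1 (v ∈ᵣ? (B · C))) (ℕ.m⊓n≤m 1 _)

    ∑-line : ∑ E² line ≤ ∣ B · C ∣ ℕ.* (∣ C ∣ ℕ.* (K ℕ.* K))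
    ∑-line = begin
      ∑ E² line
        ≡⟨ ≡.trans (∑-E² line) (∑-swap E E _) ⟩
      ∑ E (λ v → ∑ E λ m → 𝟙 (v ∈ᵣ? (B · C)) ℕ.* (1 ℕ.⊓ slopes (m * ĥ v)))
        ≡⟨ ∑-cong E (λ v → ≡.trans (∑-distribˡ-* E (𝟙 (v ∈ᵣ? (B · C))) _)
             (≡.cong (𝟙 (v ∈ᵣ? (B · C)) ℕ.*_)
               (∑-scale (ĥ v) _ (proj₂ (proj₂ (ĥ-unit v))) (≡.cong (1 ℕ.⊓_) ∘ slopes-resp)))) ⟩
      ∑ E (λ v → 𝟙 (v ∈ᵣ? (B · C)) ℕ.* ∑ E (λ s → 1 ℕ.⊓ slopes s))
        ≡⟨ ≡.trans (∑-distribʳ-* E _ _) (≡.cong (ℕ._* ∑ E (λ s → 1 ℕ.⊓ slopes s)) (≡.sym (∣A∣≡∑ (B · C)))) ⟩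
      ∣ B · C ∣ ℕ.* ∑ E (λ s → 1 ℕ.⊓ slopes s)
        ≤⟨ ℕ.*-monoʳ-≤ ∣ B · C ∣ (≤-trans (∑-mono E λ s → ℕ.m⊓n≤n 1 _) ∑-slopes) ⟩
      ∣ B · C ∣ ℕ.* (∣ C ∣ ℕ.* (K ℕ.* K)) ∎
      where open ≤-Reasoning

    -- The triple (x , y , w) produces the incidence of the point (f(x , y) / g(Y) , Y) with the line
    -- (w g(Y) / (g(x) h(y)) , v), where Y = x w and v = y w; written without division.
    Produces : Carrier × Carrier × Carrier → (Carrier × Carrier) × (Carrier × Carrier) → Set ℓ
    Produces (x , y , w) ((X , Y) , (m , v)) =
      (x ∈ A × y ∈ B × w ∈ C) × x * w ≈ Y × y * w ≈ v ×
      m * (ĝ x * ĥ y) ≈ w * ĝ Y × X * ĝ Y ≈ ĝ x * ĥ y * (x + y)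

    in-ABC? : ∀ ((x , y , w) : Carrier × Carrier × Carrier) → Dec (x ∈ A × y ∈ B × w ∈ C)
    in-ABC? (x , y , w) = (x ∈ᵣ? A) ×-dec (y ∈ᵣ? B) ×-dec (w ∈ᵣ? C)

    produces? : ∀ t i → Dec (Produces t i)
    produces? t@(x , y , w) ((X , Y) , (m , v)) =
      in-ABC? t ×-dec (x * w ≟ Y) ×-dec (y * w ≟ v) ×-dec
      (m * (ĝ x * ĥ y) ≟ w * ĝ Y) ×-dec (X * ĝ Y ≟ ĝ x * ĥ y * (x + y))

    E⁴ : List ((Carrier × Carrier) × (Carrier × Carrier))
    E⁴ = cartesianProduct E² E²

    -- The equations for `X` and `m` are solved by inverting unit values of `ĝ` and `ĥ`; listed
    -- representatives place the incidence in `E⁴`.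
    every-triple-produces : ∀ t → 𝟙 (in-ABC? t) ≤ ∑ E⁴ λ i → 𝟙 (produces? t i)
    every-triple-produces t@(x , y , w) = 𝟙≤ (in-ABC? t) λ t∈ABC →
      let (Y , Y∈ , Y≈) = representative (x * w)
          (v , v∈ , v≈) = representative (y * w)
          (gx′ , _ , gx-inv) = ĝ-unit x
          (hy′ , _ , hy-inv) = ĥ-unit y
          (gY′ , _ , gY-inv) = ĝ-unit Y
          (X , X∈ , X≈) = representative (ĝ x * ĥ y * (x + y) * gY′)
          (m , m∈ , m≈) = representative (w * ĝ Y * (gx′ * hy′))
          i = (X , Y) , (m , v)
          m-eq = begin
            m * (ĝ x * ĥ y)                         ≈⟨ *-congʳ m≈ ⟩
            w * ĝ Y * (gx′ * hy′) * (ĝ x * ĥ y)     ≈⟨ Solver.solve 5 (λ p a b c d →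
                                                         p :* (a :* b) :* (c :* d) := p :* ((c :* a) :* (d :* b)))
                                                         refl (w * ĝ Y) gx′ hy′ (ĝ x) (ĥ y) ⟩
            w * ĝ Y * ((ĝ x * gx′) * (ĥ y * hy′))   ≈⟨ *-congˡ (*-cong gx-inv hy-inv) ⟩
            w * ĝ Y * (1# * 1#)                     ≈⟨ *-congˡ (*-identityˡ 1#) ⟩
            w * ĝ Y * 1#                            ≈⟨ *-identityʳ _ ⟩
            w * ĝ Y                                 ∎
          X-eq = begin
            X * ĝ Y                                 ≈⟨ *-congʳ X≈ ⟩
            ĝ x * ĥ y * (x + y) * gY′ * ĝ Y         ≈⟨ Solver.solve 3 (λ p a b → p :* a :* b := p :* (b :* a))
                                                         refl (ĝ x * ĥ y * (x + y)) gY′ (ĝ Y) ⟩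
            ĝ x * ĥ y * (x + y) * (ĝ Y * gY′)       ≈⟨ *-congˡ gY-inv ⟩
            ĝ x * ĥ y * (x + y) * 1#                ≈⟨ *-identityʳ _ ⟩
            ĝ x * ĥ y * (x + y)                     ∎
      in ≤-trans
           (≤-reflexive (≡.sym (𝟙-yes (produces? t i) (t∈ABC , sym Y≈ , sym v≈ , m-eq , X-eq))))
           (term≤∑ (λ i → 𝟙 (produces? t i))
             (∈-cartesianProduct⁺ (∈-cartesianProduct⁺ X∈ Y∈) (∈-cartesianProduct⁺ m∈ v∈)))
      where open ≈-Reasoning

    -- Properties of an incidence produced by a triple

    module _ {x y w X Y m v : Carrier} (produces : Produces (x , y , w) ((X , Y) , (m , v))) where
      private
        x∈A = proj₁ (proj₁ produces)
        y∈B = proj₁ (proj₂ (proj₁ produces))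
        w∈C = proj₂ (proj₂ (proj₁ produces))
        xw≈Y = proj₁ (proj₂ produces)
        yw≈v = proj₁ (proj₂ (proj₂ produces))
        m-eq = proj₁ (proj₂ (proj₂ (proj₂ produces)))
        X-eq = proj₂ (proj₂ (proj₂ (proj₂ produces)))
        x∈G = A⊆G x∈A
        y∈G = B⊆G y∈B
        w∈G = C⊆G w∈C
        xw∈G = proj₂ ((x , x∈G) ∙ (w , w∈G))
        yw∈G = proj₂ ((y , y∈G) ∙ (w , w∈G))
        gx = proj₁ (g.to (x , x∈G))
        hy = proj₁ (h.to (y , y∈G))

      produced-Y∈G : Y ∈ set
      produced-Y∈G = ∈-resp xw≈Y xw∈G

      produced-v∈G : v ∈ set
      produced-v∈G = ∈-resp yw≈v yw∈G

      produced-point : point (X , Y) ≡ 1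
      produced-point = ≡.cong₂ ℕ._*_
        (𝟙-yes (Y ∈ᵣ? (A · C)) (∈-·⁺ A C (x , x∈A) (w , w∈C) xw≈Y))
        (𝟙-yes ((X * ĝ Y) ∈ᵣ? T) (∈-T⁺ (x , x∈A) (y , y∈B)
          (sym (trans X-eq (*-congʳ (*-cong (extend-∈ g x∈G refl) (extend-∈ h y∈G refl)))))))

      produced-slope : 1 ≤ slopes (m * ĥ v)
      produced-slope =
        let (w′ , w′∈ , w′≈w) = representative w
            (gx′ , gx-inv , _) = proj₂ (g.to (x , x∈G))
            (hy′ , hy-inv , _) = proj₂ (h.to (y , y∈G))
            (κ , κ∈ , κ≈) = representative (proj₁ (g.to (x * w , xw∈G)) * gx′)
            (κ′ , κ′∈ , κ′≈) = representative (proj₁ (h.to (y * w , yw∈G)) * hy′)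
            κgx : κ * gx ≈ proj₁ (g.to (x * w , xw∈G))
            κgx = trans (*-congʳ κ≈) (trans (*-assoc _ _ _) (trans (*-congˡ gx-inv) (*-identityʳ _)))
            κ′hy : κ′ * hy ≈ proj₁ (h.to (y * w , yw∈G))
            κ′hy = trans (*-congʳ κ′≈) (trans (*-assoc _ _ _) (trans (*-congˡ hy-inv) (*-identityʳ _)))
            s-eq = unit-cancel (*-unit (proj₂ (g.to (x , x∈G))) (proj₂ (h.to (y , y∈G)))) (begin
              m * ĥ v * (gx * hy)
                ≈⟨ Solver.solve 4 (λ m h a b → m :* h :* (a :* b) := m :* (a :* b) :* h) refl m (ĥ v) gx hy ⟩
              m * (gx * hy) * ĥ v
                ≈⟨ *-congʳ (*-congˡ (*-cong (extend-∈ g x∈G refl) (extend-∈ h y∈G refl))) ⟨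
              m * (ĝ x * ĥ y) * ĥ v
                ≈⟨ *-congʳ m-eq ⟩
              w * ĝ Y * ĥ v
                ≈⟨ *-cong (*-cong (sym w′≈w) (trans (extend-∈ g xw∈G (sym xw≈Y)) (sym κgx)))
                          (trans (extend-∈ h yw∈G (sym yw≈v)) (sym κ′hy)) ⟩
              w′ * (κ * gx) * (κ′ * hy)
                ≈⟨ Solver.solve 5 (λ w k a l b → w :* (k :* a) :* (l :* b) := w :* k :* l :* (a :* b))
                     refl w′ κ gx κ′ hy ⟩
              w′ * κ * κ′ * (gx * hy) ∎)
            slope≡1 : slope (m * ĥ v) (w′ , κ , κ′) ≡ 1
            slope≡1 = ≡.cong₂ ℕ._*_ (𝟙-yes (w′ ∈ᵣ? C) (∈-resp (sym w′≈w) w∈C))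
              (≡.cong₂ ℕ._*_ (isRatio⁺ g w∈G x∈G xw∈G w′≈w κgx)
              (≡.cong₂ ℕ._*_ (isRatio⁺ h w∈G y∈G yw∈G w′≈w κ′hy)
                (𝟙-yes (m * ĥ v ≟ w′ * κ * κ′) s-eq)))
        in ≤-trans (≤-reflexive (≡.sym slope≡1))
             (term≤∑ (slope (m * ĥ v)) (∈-cartesianProduct⁺ w′∈ (∈-cartesianProduct⁺ κ∈ κ′∈)))
        where open ≈-Reasoning

      produced-line : line (m , v) ≡ 1
      produced-line = ≡.cong₂ ℕ._*_
        (𝟙-yes (v ∈ᵣ? (B · C)) (∈-·⁺ B C (y , y∈B) (w , w∈C) yw≈v))
        (ℕ.m≤n⇒m⊓n≡m produced-slope)

      produced-incident : incident (X , Y) (m , v) ≡ 1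
      produced-incident = 𝟙-yes (X * m ≟ Y + v)
        -- Multiplying the equations for `X` and `m` gives the incidence equation times the unit
        -- `g(Y) g(x) h(y)`.
        (unit-cancel (*-unit (ĝ-unit Y) (*-unit (ĝ-unit x) (ĥ-unit y))) (begin
          X * m * (ĝ Y * (ĝ x * ĥ y))
            ≈⟨ Solver.solve 4 (λ X m a b → X :* m :* (a :* b) := (X :* a) :* (m :* b)) refl X m (ĝ Y) (ĝ x * ĥ y) ⟩
          (X * ĝ Y) * (m * (ĝ x * ĥ y))
            ≈⟨ *-cong X-eq m-eq ⟩
          ĝ x * ĥ y * (x + y) * (w * ĝ Y)
            ≈⟨ Solver.solve 5 (λ p x y w a → p :* (x :+ y) :* (w :* a) := (x :* w :+ y :* w) :* (a :* p))
                 refl (ĝ x * ĥ y) x y w (ĝ Y) ⟩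
          (x * w + y * w) * (ĝ Y * (ĝ x * ĥ y))
            ≈⟨ *-congʳ (+-cong xw≈Y yw≈v) ⟩
          (Y + v) * (ĝ Y * (ĝ x * ĥ y)) ∎))
        where open ≈-Reasoning

      -- Since `v / Y = (y w) / (x w) = y / x`, the factor `h(u x)` is `h(y)`, and
      -- `m g(x) h(y) = w g(Y)` is multiplied by `x`. The right-hand side depends on the incidence
      -- only.
      produced-φ : (u : Elem set) → proj₁ u * Y ≈ v → m * Func.to (φ g h u) (x , x∈G) ≈ Y * ĝ Y
      produced-φ u uY≈v = begin
        m * (x * gx * proj₁ (h.to (u ∙ (x , x∈G))))
          ≈⟨ *-congˡ (*-congˡ (h.cong {u ∙ (x , x∈G)} {y , y∈G} ux≈y)) ⟩
        m * (x * gx * hy)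
          ≈⟨ *-congˡ (*-cong (*-congˡ (extend-∈ g x∈G refl)) (extend-∈ h y∈G refl)) ⟨
        m * (x * ĝ x * ĥ y)
          ≈⟨ Solver.solve 4 (λ m x a b → m :* (x :* a :* b) := x :* (m :* (a :* b))) refl m x (ĝ x) (ĥ y) ⟩
        x * (m * (ĝ x * ĥ y))
          ≈⟨ *-congˡ m-eq ⟩
        x * (w * ĝ Y)
          ≈⟨ *-assoc x w _ ⟨
        x * w * ĝ Y
          ≈⟨ *-congʳ xw≈Y ⟩
        Y * ĝ Y ∎
        where
        open ≈-Reasoning
        ux≈y : proj₁ u * x ≈ y
        ux≈y = unit-cancel (⊆-units w∈G) (begin
          proj₁ u * x * w    ≈⟨ *-assoc _ _ _ ⟩
          proj₁ u * (x * w)  ≈⟨ *-congˡ xw≈Y ⟩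
          proj₁ u * Y        ≈⟨ uY≈v ⟩
          v                  ≈⟨ yw≈v ⟨
          y * w              ∎)

      -- `m` is a unit, because its multiple by `g(x) h(y)` is the unit `w g(Y)`.
      produced-m-cancel : ∀ {a b} → m * a ≈ m * b → a ≈ b
      produced-m-cancel {a} {b} ma≈mb = unit-cancel (*-unit (⊆-units w∈G) (ĝ-unit Y)) (begin
        a * (w * ĝ Y)            ≈⟨ *-congˡ m-eq ⟨
        a * (m * (ĝ x * ĥ y))    ≈⟨ rearrange a ⟩
        m * a * (ĝ x * ĥ y)      ≈⟨ *-congʳ ma≈mb ⟩
        m * b * (ĝ x * ĥ y)      ≈⟨ rearrange b ⟨
        b * (m * (ĝ x * ĥ y))    ≈⟨ *-congˡ m-eq ⟩
        b * (w * ĝ Y)            ∎)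
        where
        open ≈-Reasoning
        rearrange : ∀ a → a * (m * (ĝ x * ĥ y)) ≈ m * a * (ĝ x * ĥ y)
        rearrange a = Solver.solve 3 (λ a m p → a :* (m :* p) := m :* a :* p) refl a m (ĝ x * ĥ y)

      -- Once `x` is known, `w = Y / x` and then `y = v / w`; so only the number of possible `x`
      -- matters for a fixed incidence.
      produced-determined : ∀ {y′ w′} → Produces (x , y′ , w′) ((X , Y) , (m , v)) → y′ ≈ y × w′ ≈ w
      produced-determined {y′} {w′} (_ , xw′≈Y , y′w′≈v , _) =
        unit-cancel (⊆-units w∈G) (trans (*-congˡ (sym w′≈w)) (trans y′w′≈v (sym yw≈v))) , w′≈w
        where
        w′≈w : w′ ≈ w
        w′≈w = unit-cancel (⊆-units x∈G)
          (trans (*-comm w′ x) (trans xw′≈Y (trans (sym xw≈Y) (*-comm x w))))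

    -- All x belonging to triples which produce a given incidence lie in one fibre of φ_u with u = v / Y,
    -- because m φ_u(x) = Y g(Y).
    triples-producing : ∀ i → ∑ E³ (λ t → 𝟙 (produces? t i)) ≤
      K ℕ.* (point (proj₁ i) ℕ.* (line (proj₂ i) ℕ.* incident (proj₁ i) (proj₂ i)))
    -- One producing triple `t₀` serves as reference: it shows that the right-hand side is `K`, that
    -- `v / Y` lies in `G`, and which value of `φ_u` all other triples must share.
    triples-producing i@((X , Y) , (m , v)) = ∑≤-from-witness E³ _ _ λ t₀ pos → bound t₀ (𝟙-true (produces? t₀ i) pos)
      where
      open ≤-Reasoning
      bound : ∀ t₀ → Produces t₀ i → ∑ E³ (λ t → 𝟙 (produces? t i)) ≤
        K ℕ.* (point (X , Y) ℕ.* (line (m , v) ℕ.* incident (X , Y) (m , v)))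
      bound t₀@(x₀ , y₀ , w₀) produces₀ = begin
        ∑ E³ (λ t → 𝟙 (produces? t i))
          ≡⟨ ∑-cartesianProduct E E² _ ⟩
        ∑ E (λ x → ∑ E² λ (y , w) → 𝟙 (produces? (x , y , w) i))
          ≤⟨ ∑-mono E (λ x → ∑≤-from-witness E² _ _ λ (y , w) pos →
               at-most-one x y w (𝟙-true (produces? (x , y , w) i) pos)) ⟩
        ∑ E (λ x → 𝟙 (x ∈ᵣ? fibre set (φ g h u) (element j)))
          ≡⟨ ∣A∣≡∑ (fibre set (φ g h u) (element j)) ⟨
        ∣ fibre set (φ g h u) (element j) ∣
          ≤⟨ ∣fibre∣≤μ set (φ g h u) j ⟩
        μ set (φ g h u)
          ≤⟨ φ-fibres u ⟩
        K
          ≡⟨ ℕ.*-identityʳ K ⟨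
        K ℕ.* 1
          ≡⟨ ≡.cong (K ℕ.*_) (≡.cong₂ ℕ._*_ (produced-point produces₀)
               (≡.cong₂ ℕ._*_ (produced-line produces₀) (produced-incident produces₀))) ⟨
        K ℕ.* (point (X , Y) ℕ.* (line (m , v) ℕ.* incident (X , Y) (m , v))) ∎
        where
        Y∈G = produced-Y∈G produces₀
        Y⁻¹∈G = ⁻¹-closed (Y , ⊆-units Y∈G) Y∈G
        u : Elem set
        u = (v , produced-v∈G produces₀) ∙ (proj₁ (⊆-units Y∈G) , Y⁻¹∈G)
        uY≈v : proj₁ u * Y ≈ v
        uY≈v = trans (*-assoc _ _ _) (trans (*-congˡ (proj₁ (proj₂ (⊆-units Y∈G)))) (*-identityʳ v))
        j : Fin size
        j = index (Func.to (φ g h u) (x₀ , A⊆G (proj₁ (proj₁ produces₀))))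

        at-most-one : ∀ x y w → Produces (x , y , w) i →
          ∑ E² (λ (y′ , w′) → 𝟙 (produces? (x , y′ , w′) i)) ≤ 𝟙 (x ∈ᵣ? fibre set (φ g h u) (element j))
        at-most-one x y w produces = begin
          ∑ E² (λ (y′ , w′) → 𝟙 (produces? (x , y′ , w′) i))
            ≤⟨ ∑-mono E² (λ (y′ , w′) → 𝟙≤ (produces? (x , y′ , w′) i) λ produces′ →
                 let (y′≈y , w′≈w) = produced-determined produces produces′ in
                 ≤-reflexive (≡.sym (≡.cong₂ ℕ._*_ (𝟙-yes (y′ ≟ y) y′≈y) (𝟙-yes (w′ ≟ w) w′≈w)))) ⟩
          ∑ E² (λ (y′ , w′) → 𝟙 (y′ ≟ y) ℕ.* 𝟙 (w′ ≟ w))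
            ≡⟨ ≡.trans (∑-E² _) (∑-separate E E _ _) ⟩
          ∑ E (λ y′ → 𝟙 (y′ ≟ y)) ℕ.* ∑ E (λ w′ → 𝟙 (w′ ≟ w))
            ≡⟨ ≡.cong₂ ℕ._*_ (∑-unique (_≟ y) y (λ _ → id) (λ _ → id)) (∑-unique (_≟ w) w (λ _ → id) (λ _ → id)) ⟩
          1
            ≡⟨ 𝟙-yes (x ∈ᵣ? fibre set (φ g h u) (element j)) (∈-fibre⁺ set (φ g h u)
                 (x , A⊆G (proj₁ (proj₁ produces))) refl same-φ) ⟨
          𝟙 (x ∈ᵣ? fibre set (φ g h u) (element j)) ∎
          where
          same-φ : Func.to (φ g h u) (x , A⊆G (proj₁ (proj₁ produces))) ≈ element j
          same-φ = trans
            (produced-m-cancel produces₀ (trans (produced-φ produces u uY≈v) (sym (produced-φ produces₀ u uY≈v))))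
            (sym (element-index _))

    ∑-in-ABC : ∑ E³ (𝟙 ∘ in-ABC?) ≡ ∣ A ∣ ℕ.* (∣ B ∣ ℕ.* ∣ C ∣)
    ∑-in-ABC = begin
      ∑ E³ (𝟙 ∘ in-ABC?)
        ≡⟨ ∑-cong E³ (λ (x , y , w) → ≡.trans (𝟙-× (x ∈ᵣ? A) ((y ∈ᵣ? B) ×-dec (w ∈ᵣ? C)))
             (≡.cong (𝟙 (x ∈ᵣ? A) ℕ.*_) (𝟙-× (y ∈ᵣ? B) (w ∈ᵣ? C)))) ⟩
      ∑ E³ (λ (x , y , w) → 𝟙 (x ∈ᵣ? A) ℕ.* (𝟙 (y ∈ᵣ? B) ℕ.* 𝟙 (w ∈ᵣ? C)))
        ≡⟨ ≡.trans (∑-cartesianProduct E E² _) (∑-separate E E² _ _) ⟩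
      ∑ E (λ x → 𝟙 (x ∈ᵣ? A)) ℕ.* ∑ E² (λ (y , w) → 𝟙 (y ∈ᵣ? B) ℕ.* 𝟙 (w ∈ᵣ? C))
        ≡⟨ ≡.cong (∑ E (λ x → 𝟙 (x ∈ᵣ? A)) ℕ.*_) (≡.trans (∑-E² _) (∑-separate E E _ _)) ⟩
      ∑ E (λ x → 𝟙 (x ∈ᵣ? A)) ℕ.* (∑ E (λ y → 𝟙 (y ∈ᵣ? B)) ℕ.* ∑ E (λ w → 𝟙 (w ∈ᵣ? C)))
        ≡⟨ ≡.cong₂ ℕ._*_ (∣A∣≡∑ A) (≡.cong₂ ℕ._*_ (∣A∣≡∑ B) (∣A∣≡∑ C)) ⟨
      ∣ A ∣ ℕ.* (∣ B ∣ ℕ.* ∣ C ∣) ∎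
      where open ≡.≡-Reasoning

    incidences : ℕ
    incidences = ∑ E² λ p → point p ℕ.* ∑ E² λ l → line l ℕ.* incident p l

    -- Double counting of pairs of a triple and an incidence that it produces. Off the selected
    -- points and lines the bound of `triples-producing` is 0, so only counted incidences
    -- contribute.
    ∣A∣∣B∣∣C∣≤ : ∣ A ∣ ℕ.* (∣ B ∣ ℕ.* ∣ C ∣) ≤ K ℕ.* incidences
    ∣A∣∣B∣∣C∣≤ = begin
      ∣ A ∣ ℕ.* (∣ B ∣ ℕ.* ∣ C ∣)
        ≡⟨ ∑-in-ABC ⟨
      ∑ E³ (𝟙 ∘ in-ABC?)
        ≤⟨ ∑≤-fibres E³ E⁴ (λ t i → 𝟙 (produces? t i)) K every-triple-produces triples-producing ⟩
      K ℕ.* ∑ E⁴ (λ (p , l) → point p ℕ.* (line l ℕ.* incident p l))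
        ≡⟨ ≡.cong (K ℕ.*_) (≡.trans (∑-cartesianProduct E² E² _)
             (∑-cong E² λ p → ∑-distribˡ-* E² (point p) (λ l → line l ℕ.* incident p l))) ⟩
      K ℕ.* incidences ∎
      where open ≤-Reasoning

    expansion :
      let N = ∣ A ∣ ℕ.* (∣ B ∣ ℕ.* ∣ C ∣)
          Z = ∣ T ∣ ℕ.* ∣ A · C ∣ ℕ.* ∣ B · C ∣
      in size ℕ.* N ≤ 2 ℕ.* (K ℕ.* K ℕ.* K) ℕ.* (Z ℕ.* ∣ C ∣)
       ⊎ N ℕ.* N ≤ 4 ℕ.* (K ℕ.* K ℕ.* K ℕ.* K) ℕ.* (Z ℕ.* ∣ C ∣) ℕ.* excess
    expansion = incidences⇒expansion K size _ incidences _ _ excess (∣ T ∣) (∣ A · C ∣) (∣ B · C ∣) (∣ C ∣)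
      ∣A∣∣B∣∣C∣≤ (≤-reflexive ∑-point) ∑-line (incidence-bound point line point≤1 line≤1)

-- The constant and the passage to rational numbers

open import Data.Integer.Base as ℤ using (+_)

-- The reciprocal of the constant `c`. It dominates both `2 K³` and `4 r K⁴`; `suc r` in place of
-- `r` keeps it nonzero for `r = 0`.
loss : ℕ → ℕ → ℕ
loss r k = 4 ℕ.* suc r ℕ.* (k ℕ.* k ℕ.* k ℕ.* k)

loss≢0 : ∀ r k .{{_ : NonZero k}} → NonZero (loss r k)
loss≢0 r k@(suc _) = _

-- Both alternatives carry a common factor `c = |C|`. The final factors `1` and `D` are the
-- denominators of the two terms of the minimum.
cancel-∣C∣ : ∀ r k a b c {s n D e Z} .{{_ : NonZero k}} → s ≡ n → e ≤ r ℕ.* D →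
  s ℕ.* (a ℕ.* (b ℕ.* c)) ≤ 2 ℕ.* (k ℕ.* k ℕ.* k) ℕ.* (Z ℕ.* c)
  ⊎ a ℕ.* (b ℕ.* c) ℕ.* (a ℕ.* (b ℕ.* c)) ≤ 4 ℕ.* (k ℕ.* k ℕ.* k ℕ.* k) ℕ.* (Z ℕ.* c) ℕ.* e →
  n ℕ.* a ℕ.* b ≤ loss r k ℕ.* Z ℕ.* 1 ⊎ a ℕ.^ 2 ℕ.* b ℕ.^ 2 ℕ.* c ≤ loss r k ℕ.* Z ℕ.* D
-- For empty `C` nothing can be cancelled, but the second term of the minimum vanishes.
cancel-∣C∣ r k a b zero _ _ _ = inj₂ (≤-trans (≤-reflexive (ℕ.*-zeroʳ (a ℕ.^ 2 ℕ.* b ℕ.^ 2))) z≤n)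
cancel-∣C∣ r k@(suc _) a b c@(suc _) {n = n} {Z = Z} ≡.refl _ (inj₁ le) = inj₁ (ℕ.*-cancelʳ-≤ _ _ c (begin
  n ℕ.* a ℕ.* b ℕ.* c                                           ≡⟨ r₁ n a b c ⟩
  n ℕ.* (a ℕ.* (b ℕ.* c))                                       ≤⟨ le ⟩
  -- The padding factor `2 (r + 1) k` raises `2 k³` to the common constant `4 (r + 1) k⁴`.
  2 ℕ.* (k ℕ.* k ℕ.* k) ℕ.* (Z ℕ.* c)                           ≤⟨ ℕ.m≤m*n _ (2 ℕ.* suc r ℕ.* k) ⟩
  2 ℕ.* (k ℕ.* k ℕ.* k) ℕ.* (Z ℕ.* c) ℕ.* (2 ℕ.* suc r ℕ.* k)   ≡⟨ r₂ k Z c (suc r) ⟩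
  4 ℕ.* suc r ℕ.* (k ℕ.* k ℕ.* k ℕ.* k) ℕ.* Z ℕ.* 1 ℕ.* c       ∎))
  where
  open ≤-Reasoning
  r₁ : ∀ n a b c → n ℕ.* a ℕ.* b ℕ.* c ≡ n ℕ.* (a ℕ.* (b ℕ.* c))
  r₁ = solve-∀
  r₂ : ∀ k Z c s → 2 ℕ.* (k ℕ.* k ℕ.* k) ℕ.* (Z ℕ.* c) ℕ.* (2 ℕ.* s ℕ.* k) ≡
                   4 ℕ.* s ℕ.* (k ℕ.* k ℕ.* k ℕ.* k) ℕ.* Z ℕ.* 1 ℕ.* c
  r₂ = solve-∀
cancel-∣C∣ r k a b c@(suc _) {D = D} {e} {Z} _ e≤rD (inj₂ le) = inj₂ (ℕ.*-cancelʳ-≤ _ _ c (begin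
  a ℕ.^ 2 ℕ.* b ℕ.^ 2 ℕ.* c ℕ.* c                               ≡⟨ r₁ a b c ⟩
  a ℕ.* (b ℕ.* c) ℕ.* (a ℕ.* (b ℕ.* c))                         ≤⟨ le ⟩
  4 ℕ.* (k ℕ.* k ℕ.* k ℕ.* k) ℕ.* (Z ℕ.* c) ℕ.* e               ≤⟨ ℕ.*-monoʳ-≤ (4 ℕ.* (k ℕ.* k ℕ.* k ℕ.* k) ℕ.* (Z ℕ.* c))
                                                                     (≤-trans e≤rD (ℕ.*-monoˡ-≤ D (ℕ.n≤1+n r))) ⟩
  4 ℕ.* (k ℕ.* k ℕ.* k ℕ.* k) ℕ.* (Z ℕ.* c) ℕ.* (suc r ℕ.* D)   ≡⟨ r₂ k Z c (suc r) D ⟩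
  4 ℕ.* suc r ℕ.* (k ℕ.* k ℕ.* k ℕ.* k) ℕ.* Z ℕ.* D ℕ.* c       ∎))
  where
  open ≤-Reasoning
  r₁ : ∀ a b c → a ℕ.* (a ℕ.* 1) ℕ.* (b ℕ.* (b ℕ.* 1)) ℕ.* c ℕ.* c ≡ a ℕ.* (b ℕ.* c) ℕ.* (a ℕ.* (b ℕ.* c))
  r₁ = solve-∀
  r₂ : ∀ k Z c s D → 4 ℕ.* (k ℕ.* k ℕ.* k ℕ.* k) ℕ.* (Z ℕ.* c) ℕ.* (s ℕ.* D) ≡
                     4 ℕ.* s ℕ.* (k ℕ.* k ℕ.* k ℕ.* k) ℕ.* Z ℕ.* D ℕ.* c
  r₂ = solve-∀

0<1/ : ∀ M .{{_ : NonZero M}} → 0ℚᵘ ℚᵘ.< + 1 / M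
0<1/ M@(suc _) = ℚᵘ.positive⁻¹ (+ 1 / M)

scaled≤ : ∀ M D y Z .{{_ : NonZero M}} .{{_ : NonZero D}} → y ≤ M ℕ.* Z ℕ.* D →
          (+ 1 / M) ℚᵘ.* (+ y / D) ℚᵘ.≤ + Z / 1
scaled≤ M@(suc _) D@(suc _) y Z y≤ = ℚᵘ.*≤* (begin
  + 1 ℤ.* + y ℤ.* + 1    ≡⟨ ≡.trans (ℤ.*-identityʳ _) (ℤ.*-identityˡ (+ y)) ⟩
  + y                    ≤⟨ ℤ.+≤+ y≤ ⟩
  + (M ℕ.* Z ℕ.* D)      ≡⟨ ≡.cong +_ (r M Z D) ⟩
  + (Z ℕ.* (M ℕ.* D))    ≡⟨ ℤ.pos-* Z (M ℕ.* D) ⟩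
  + Z ℤ.* + (M ℕ.* D)    ∎)
  where
  open ℤ.≤-Reasoning
  r : ∀ M Z D → M ℕ.* Z ℕ.* D ≡ Z ℕ.* (M ℕ.* D)
  r = solve-∀

-- The minimum lies below each of its terms, so either alternative is enough.
scaled-⊓≤ : ∀ M D x y Z .{{_ : NonZero M}} .{{_ : NonZero D}} →
            x ≤ M ℕ.* Z ℕ.* 1 ⊎ y ≤ M ℕ.* Z ℕ.* D →
            (+ 1 / M) ℚᵘ.* ((+ x / 1) ⊓ (+ y / D)) ℚᵘ.≤ + Z / 1
scaled-⊓≤ M@(suc _) D x y Z (inj₁ x≤) = ℚᵘ.≤-trans
  (ℚᵘ.*-monoʳ-≤-nonNeg (+ 1 / M) (ℚᵘ.p⊓q≤p (+ x / 1) (+ y / D))) (scaled≤ M 1 x Z x≤)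
scaled-⊓≤ M@(suc _) D x y Z (inj₂ y≤) = ℚᵘ.≤-trans
  (ℚᵘ.*-monoʳ-≤-nonNeg (+ 1 / M) (ℚᵘ.p⊓q≤q (+ x / 1) (+ y / D))) (scaled≤ M D y Z y≤)

theorem1p14 :
  ∀ {a ℓ} (r K : ℕ) → 1 ≤ K →
  ∃ λ (c : ℚᵘ) → 0ℚᵘ ℚᵘ.< c ×
    ((R : FiniteValuationRing a ℓ) →
     let
       open FiniteValuationRing R
     in
     (q : ℕ) (z : Carrier) →
     IsUniformizer z →
     HasNilpotencyDegree z r →
     (card : HasCardinality R/⟨ z ⟩ q) →
     (G : UnitSubgroup) →
     let
       open UnitSubgroup G
     in
     (g h : Func ⟨ set ⟩ Rˣ.setoid) →
     (∀ w → ∣ range set (ratio g w) ∣ ≤ K) →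
     (∀ w → ∣ range set (ratio h w) ∣ ≤ K) →
     (∀ u → μ set (φ g h u) ≤ K) →
     ∀ (A B C : Subset size) (A⊆G : A ⊆ set) (B⊆G : B ⊆ set) → C ⊆ set →
     let
       instance
         q≢0 : NonZero q
         q≢0 = residueCardinality-nonZero card
         q^≢0 : NonZero (q ℕ.^ (2 ℕ.* r ∸ 1))
         q^≢0 = m^n≢0 q (2 ℕ.* r ∸ 1)
     in
     c ℚᵘ.* ( ((+ (q ℕ.^ r ℕ.* ∣ A ∣ ℕ.* ∣ B ∣)) / 1)
            ⊓ ((+ (∣ A ∣ ℕ.^ 2 ℕ.* ∣ B ∣ ℕ.^ 2 ℕ.* ∣ C ∣)) / (q ℕ.^ (2 ℕ.* r ∸ 1))) )
     ℚᵘ.≤ (+ (∣ image₂ (f g h) A⊆G B⊆G ∣ ℕ.* ∣ A · C ∣ ℕ.* ∣ B · C ∣)) / 1)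
theorem1p14 r K 1≤K = + 1 / loss r K , 0<1/ (loss r K) ,
  λ 𝓡 q z uniformizer nilpotency card G g h g-ratios h-ratios φ-fibres A B C A⊆G B⊆G C⊆G →
    let
      open FiniteValuationRing 𝓡 using (finiteCommutativeRing; residueCardinality-nonZero)
      open UniformizerCounting 𝓡 uniformizer nilpotency card using (size≡qʳ; excess-bound)
      open TripleCounting finiteCommutativeRing G g h g-ratios h-ratios φ-fibres A B C A⊆G B⊆G C⊆G
        using (expansion)
    in
    scaled-⊓≤ (loss r K) (q ℕ.^ (2 ℕ.* r ∸ 1)) _ _ _
      {{loss≢0 r K}} {{m^n≢0 q (2 ℕ.* r ∸ 1) {{residueCardinality-nonZero card}}}}
      (cancel-∣C∣ r K (∣ A ∣) (∣ B ∣) (∣ C ∣) size≡qʳ excess-bound expansion)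
  where
  instance
    K≢0 : NonZero K
    K≢0 = ℕ.>-nonZero 1≤K
    M≢0 : NonZero (loss r K)
    M≢0 = loss≢0 r K
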